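{- Let $w(n)$ be the number of cells turned from OFF to ON at stage $n$ of the Rule 942 cellular automaton and $u(n)$ the number of cells turned from OFF to ON at stage $n$ of the Ulam-Warburton cellular automaton (both defined in the context), and let $\delta(n)=\tfrac14\left(w(4n+1)-u(4n+1)\right)$. Then $\delta(0)=0$, $\delta(1)=1$, $\delta(2)=6$, and for $n\ge3$, writing $n=2^k+j$ with $1\le j\le 2^k$ and $j=2^m(2l+1)$ with $m,l\ge0$, we have $$ \delta(n)=4\left(3^{m+1}-2^{m+1}\right)3^{\mathrm{wt}(l)}, $$ except that if $j=2^k$ then $$ \delta(n)=4\cdot 3^{k+1}-3\cdot 2^{k+1}. $$
   Context: Both automata live on the cells of the infinite square grid, the neighbors of a cell being the four cells sharing an edge with it. Cells are OFF or ON; once ON a cell stays ON. At stage $0$ no cell is ON; at stage $1$ a single cell is turned ON. In the Ulam-Warburton cellular automaton, at stage $n\ge2$ an OFF cell is turned ON if and only if exactly one of its four neighbors was ON after stage $n-1$. In the Rule 942 cellular automaton, at stage $n\ge2$ an OFF cell is turned ON if and only if exactly one or all four of its four neighbors were ON after stage $n-1$. $u(0)=w(0)=0$. $\mathrm{wt}(l)$ denotes the number of $1$'s in the binary expansion of $l$. -}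

module Defs where

open import Data.Bool using (Bool; true; false; _∧_; _∨_; not; if_then_else_)
open import Data.Nat as ℕ using (ℕ; zero; suc; _%_; _/_)
open import Data.Integer as ℤ using (ℤ; +_; _-_)
open import Data.List using (List; map; upTo; concatMap)
open import Data.Nat.ListAction using (sum)
open import Relation.Nullary.Decidable using (⌊_⌋)

Config : Set
Config = ℤ → ℤ → Bool

b2n : Bool → ℕ
b2n true  = 1
b2n false = 0

onNbrs : Config → ℤ → ℤ → ℕ
onNbrs c x y =
  b2n (c (x ℤ.+ + 1) y) ℕ.+ b2n (c (x - + 1) y) ℕ.+
  b2n (c x (y ℤ.+ + 1)) ℕ.+ b2n (c x (y - + 1))

on : (ℕ → Bool) → ℕ → Config
on rule zero x y = false
on rule (suc zero) x y = ⌊ x ℤ.≟ + 0 ⌋ ∧ ⌊ y ℤ.≟ + 0 ⌋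
on rule (suc (suc n)) x y =
  on rule (suc n) x y ∨ rule (onNbrs (on rule (suc n)) x y)

ruleUW : ℕ → Bool
ruleUW k = ⌊ k ℕ.≟ 1 ⌋

rule942 : ℕ → Bool
rule942 k = ⌊ k ℕ.≟ 1 ⌋ ∨ ⌊ k ℕ.≟ 4 ⌋

range : ℕ → List ℤ
range r = map (λ i → + i - + r) (upTo (suc (r ℕ.+ r)))

turnedOn : (ℕ → Bool) → ℕ → ℤ → ℤ → Bool
turnedOn rule zero x y = false
turnedOn rule (suc n) x y = on rule (suc n) x y ∧ not (on rule n x y)

-- Number of cells turned from OFF to ON at stage n.  All cells ON after stage n
-- lie in the box [-n,n]², since every newly-ON cell has an ON neighbour
-- (|x|+|y| ≤ n-1), so counting over that box counts all of them.
newCount : (ℕ → Bool) → ℕ → ℕ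
newCount rule n =
  sum (concatMap (λ x → map (λ y → b2n (turnedOn rule n x y)) (range n)) (range n))

u : ℕ → ℕ
u = newCount ruleUW

w : ℕ → ℕ
w = newCount rule942

fourδ : ℕ → ℤ
fourδ n = + w (4 ℕ.* n ℕ.+ 1) - + u (4 ℕ.* n ℕ.+ 1)

wtAux : ℕ → ℕ → ℕ
wtAux zero n = 0
wtAux (suc f) n = n % 2 ℕ.+ wtAux f (n / 2)

wt : ℕ → ℕ
wt n = wtAux n n

{-# OPTIONS --safe #-}
module Submission where

-- Doubling coordinates and stages maps the Ulam-Warburton automaton U into itself: U(2m) and
-- U(2m+1) restricted to (2x, 2y) are U(m) and U(m+1), a cell midway between two neighbouring
-- doubled cells is ON at stages 2m and 2m+1 iff one of the two is ON in U(m), and (odd, odd)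
-- cells stay OFF for ever.
--
-- Rule 942 differs from U only by filling, one stage later, the holes of U: the OFF cells with
-- four ON neighbours.  A filled hole influences no other cell, so w(n+1) - u(n+1) is the
-- increment of the number of holes of U into stage n.  Sorting cells by the parities of their
-- coordinates gives, for n = 2m and n = 2m+1,
--   holes(n)   = holes(m) + squares(m),
--   squares(n) = 4 cells(m) + corners(m),
--   corners(n) = squares(n) + corners(m),
-- where squares counts the unit squares with an ON diagonal and corners the OFF corners of unit
-- squares whose two adjacent corners are ON.  As the ON cells form a tree, also
--   cells(n) = cells(⌈n/2⌉) + 3 cells(m) + 1.
-- The increments of these counts are then found along n = 2^i q with q odd.

open import Defs
open import Data.Bool using (Bool; true; false; _∧_; _∨_; not)
import Data.Bool.Properties as 𝔹
open import Data.Nat using (ℕ; _+_; _*_; _^_; _≤_)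
open import Data.Nat as ℕ using (zero; suc; _<_; z≤n; s≤s; _/_; _%_)
import Data.Nat.DivMod as ℕ
open import Data.Nat.Divisibility using (divides)
open import Data.Nat.Induction using (<-rec)
open import Data.Nat.ListAction using (sum)
open import Data.Nat.ListAction.Properties using (sum-++)
import Data.Nat.Properties as ℕ
import Data.Nat.Tactic.RingSolver as ℕRing
open import Data.Integer using (ℤ; +_) renaming (_*_ to _*ℤ_; _-_ to _-ℤ_)
open import Data.Integer using (-[1+_]; ∣_∣; -_) renaming (_+_ to _+ℤ_)
import Data.Integer.Properties as ℤ
open import Data.Integer.Tactic.RingSolver using (solve-∀)
open import Data.List using (List; []; _∷_; _++_; map; concatMap; upTo; applyUpTo)
import Data.List.Properties as List
open import Data.Product using (_×_; _,_; proj₁; proj₂; ∃)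
open import Data.Sum using (_⊎_; inj₁; inj₂)
open import Function using (_∘_)
open import Relation.Nullary using (Dec)
open import Relation.Nullary.Decidable using (from-yes; _→-dec_; map′; _×-dec_)
open import Relation.Binary.PropositionalEquality

-- Halving coordinates and stages

-- Reduces every claim about the states of finitely many cells to a truth table, which `from-yes`
-- evaluates.
∀-Bool? : {P : Bool → Set} → (∀ b → Dec (P b)) → Dec (∀ b → P b)
∀-Bool? P? = map′ (λ { (f , t) false → f ; (f , t) true → t }) (λ p → p false , p true)
                  (P? false ×-dec P? true)

dbl : ℕ → ℕ
dbl zero    = zero
dbl (suc n) = suc (suc (dbl n))

-- The indices are n and the ceiling and floor of n/2, so that one statement covers both parities of
-- a stage.
data Halves : ℕ → ℕ → ℕ → Set where
  even : ∀ m → Halves (dbl m) m m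
  odd  : ∀ m → Halves (suc (dbl m)) (suc m) m

halves : ∀ n → ∃ λ c → ∃ λ f → Halves n c f
halves zero = _ , _ , even zero
halves (suc n) with halves n
... | _ , _ , even m = _ , _ , odd m
... | _ , _ , odd m  = _ , _ , even (suc m)

n≤dbl : ∀ n → n ≤ dbl n
n≤dbl zero    = z≤n
n≤dbl (suc n) = s≤s (ℕ.m≤n⇒m≤1+n (n≤dbl n))

evℤ odℤ : ℤ → ℤ
evℤ (+ i)    = + dbl i
evℤ -[1+ i ] = -[1+ suc (dbl i) ]
odℤ (+ i)    = + suc (dbl i)
odℤ -[1+ i ] = -[1+ dbl i ]

data Parity : ℤ → Set where
  ev : ∀ x → Parity (evℤ x)
  od : ∀ x → Parity (odℤ x)

parity : ∀ x → Parity x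
parity (+ i) with halves i
... | _ , _ , even m = ev (+ m)
... | _ , _ , odd m  = od (+ m)
parity -[1+ i ] with halves i
... | _ , _ , even m = od -[1+ m ]
... | _ , _ , odd m  = ev -[1+ m ]

x-1+1 : ∀ x → (x -ℤ + 1) +ℤ + 1 ≡ x
x-1+1 = solve-∀

x+1-1 : ∀ x → (x +ℤ + 1) -ℤ + 1 ≡ x
x+1-1 = solve-∀

ev+1 : ∀ x → evℤ x +ℤ + 1 ≡ odℤ x
ev+1 (+ i)    = cong +_ (ℕ.+-comm (dbl i) 1)
ev+1 -[1+ i ] = refl

od+1 : ∀ x → odℤ x +ℤ + 1 ≡ evℤ (x +ℤ + 1)
od+1 (+ i) rewrite ℕ.+-comm i 1 = cong (+_ ∘ suc) (ℕ.+-comm (dbl i) 1)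
od+1 -[1+ zero ]  = refl
od+1 -[1+ suc i ] = refl

od-1 : ∀ x → odℤ x -ℤ + 1 ≡ evℤ x
od-1 x = trans (cong (_-ℤ + 1) (sym (ev+1 x))) (x+1-1 (evℤ x))

ev-1 : ∀ x → evℤ x -ℤ + 1 ≡ odℤ (x -ℤ + 1)
ev-1 x = trans (cong (λ z → evℤ z -ℤ + 1) (sym (x-1+1 x)))
        (trans (cong (_-ℤ + 1) (sym (od+1 (x -ℤ + 1)))) (x+1-1 (odℤ (x -ℤ + 1))))

U : ℕ → Config
U = on ruleUW

one4 : Bool → Bool → Bool → Bool → Bool
one4 e w n s = ruleUW (b2n e + b2n w + b2n n + b2n s)

U-step : ∀ k {x y c e w n s} → U (suc k) x y ≡ c →
         U (suc k) (x +ℤ + 1) y ≡ e → U (suc k) (x -ℤ + 1) y ≡ w →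
         U (suc k) x (y +ℤ + 1) ≡ n → U (suc k) x (y -ℤ + 1) ≡ s →
         U (suc (suc k)) x y ≡ c ∨ one4 e w n s
U-step k refl refl refl refl refl = refl

U-mono : ∀ k x y → U k x y ∨ U (suc k) x y ≡ U (suc k) x y
U-mono zero    x y = refl
U-mono (suc k) x y = from-yes (∀-Bool? λ c → ∀-Bool? λ o → (c ∨ (c ∨ o)) 𝔹.≟ (c ∨ o))
  (U (suc k) x y) (ruleUW (onNbrs (U (suc k)) x y))

-- The rule for stage `k` has been applied in stage `suc k`, so applying it again adds nothing; at
-- stage 0 no cell has an ON neighbour.
U-closed : ∀ k x y → U (suc k) x y ∨
           one4 (U k (x +ℤ + 1) y) (U k (x -ℤ + 1) y) (U k x (y +ℤ + 1)) (U k x (y -ℤ + 1))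
           ≡ U (suc k) x y
U-closed zero    x y = 𝔹.∨-identityʳ _
U-closed (suc k) x y = from-yes (∀-Bool? λ c → ∀-Bool? λ o → ((c ∨ o) ∨ o) 𝔹.≟ (c ∨ o))
  (U (suc k) x y) (ruleUW (onNbrs (U (suc k)) x y))

-- n, c and f stand for a stage, the ceiling of its half and the floor of its half.
record HalvesAt (n c f : ℕ) : Set where
  field
    evev : ∀ x y → U n (evℤ x) (evℤ y) ≡ U c x y
    odev : ∀ x y → U n (odℤ x) (evℤ y) ≡ U f x y ∨ U f (x +ℤ + 1) y
    evod : ∀ x y → U n (evℤ x) (odℤ y) ≡ U f x y ∨ U f x (y +ℤ + 1)
    odod : ∀ x y → U n (odℤ x) (odℤ y) ≡ false

  odev+ : ∀ x y → U n (evℤ x +ℤ + 1) (evℤ y) ≡ U f x y ∨ U f (x +ℤ + 1) y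
  odev+ x y rewrite ev+1 x = odev x y

  odev- : ∀ x y → U n (evℤ x -ℤ + 1) (evℤ y) ≡ U f (x -ℤ + 1) y ∨ U f x y
  odev- x y rewrite ev-1 x =
    trans (odev (x -ℤ + 1) y) (cong (λ z → U f (x -ℤ + 1) y ∨ U f z y) (x-1+1 x))

  evod+ : ∀ x y → U n (evℤ x) (evℤ y +ℤ + 1) ≡ U f x y ∨ U f x (y +ℤ + 1)
  evod+ x y rewrite ev+1 y = evod x y

  evod- : ∀ x y → U n (evℤ x) (evℤ y -ℤ + 1) ≡ U f x (y -ℤ + 1) ∨ U f x y
  evod- x y rewrite ev-1 y =
    trans (evod x (y -ℤ + 1)) (cong (λ z → U f x (y -ℤ + 1) ∨ U f x z) (x-1+1 y))

-- Expresses that no two horizontal or vertical neighbours are turned ON together at stage `suc k`.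
Independent : ℕ → Set
Independent k =
    (∀ x y → (U (suc k) x y ∧ U (suc k) (x +ℤ + 1) y) ∧ not (U k x y ∨ U k (x +ℤ + 1) y) ≡ false)
  × (∀ x y → (U (suc k) x y ∧ U (suc k) x (y +ℤ + 1)) ∧ not (U k x y ∨ U k x (y +ℤ + 1)) ≡ false)

module Step {k c f : ℕ} (h : HalvesAt (suc k) c f) where
  open HalvesAt h

  step-evev : ∀ x y → U (suc (suc k)) (evℤ x) (evℤ y) ≡
    U c x y ∨ one4 (U f x y ∨ U f (x +ℤ + 1) y) (U f (x -ℤ + 1) y ∨ U f x y)
                   (U f x y ∨ U f x (y +ℤ + 1)) (U f x (y -ℤ + 1) ∨ U f x y)
  step-evev x y = U-step k (evev x y) (odev+ x y) (odev- x y) (evod+ x y) (evod- x y)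

  step-odev : ∀ x y → U (suc (suc k)) (odℤ x) (evℤ y) ≡
    (U f x y ∨ U f (x +ℤ + 1) y) ∨ one4 (U c (x +ℤ + 1) y) (U c x y) false false
  step-odev x y = U-step k (odev x y)
    (trans (cong (λ z → U (suc k) z (evℤ y)) (od+1 x)) (evev _ y))
    (trans (cong (λ z → U (suc k) z (evℤ y)) (od-1 x)) (evev x y))
    (trans (cong (U (suc k) (odℤ x)) (ev+1 y)) (odod x y))
    (trans (cong (U (suc k) (odℤ x)) (ev-1 y)) (odod x _))

  step-evod : ∀ x y → U (suc (suc k)) (evℤ x) (odℤ y) ≡
    (U f x y ∨ U f x (y +ℤ + 1)) ∨ one4 false false (U c x (y +ℤ + 1)) (U c x y)
  step-evod x y = U-step k (evod x y)
    (trans (cong (λ z → U (suc k) z (odℤ y)) (ev+1 x)) (odod x y))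
    (trans (cong (λ z → U (suc k) z (odℤ y)) (ev-1 x)) (odod _ y))
    (trans (cong (U (suc k) (evℤ x)) (od+1 y)) (evev x _))
    (trans (cong (U (suc k) (evℤ x)) (od-1 y)) (evev x y))

  -- The four neighbours are the sides of a square, ON when they have an ON endpoint, and no
  -- set of vertices of a 4-cycle touches exactly one side.
  step-odod : ∀ x y → U (suc (suc k)) (odℤ x) (odℤ y) ≡ false
  step-odod x y = trans
    (U-step k (odod x y)
      (trans (cong (λ z → U (suc k) z (odℤ y)) (od+1 x)) (evod _ y))
      (trans (cong (λ z → U (suc k) z (odℤ y)) (od-1 x)) (evod x y))
      (trans (cong (U (suc k) (odℤ x)) (od+1 y)) (odev x _))
      (trans (cong (U (suc k) (odℤ x)) (od-1 y)) (odev x y)))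
    (from-yes (∀-Bool? λ a → ∀-Bool? λ b → ∀-Bool? λ c → ∀-Bool? λ d →
        one4 (b ∨ d) (a ∨ c) (c ∨ d) (a ∨ b) 𝔹.≟ false)
      (U f x y) (U f (x +ℤ + 1) y) (U f x (y +ℤ + 1)) (U f (x +ℤ + 1) (y +ℤ + 1)))

-- Applied from stage 2p + 1 to 2p + 2. Around a doubled cell that is OFF in U(p) the midpoints show
-- its four neighbours in U(p); if exactly one is ON, the cell is already ON in U(p + 1). A midpoint
-- with exactly one ON end is turned ON, and by independence one with two ON ends was ON before.
to-even : ∀ {k p} → Independent p → HalvesAt (suc k) (suc p) p →
          HalvesAt (suc (suc k)) (suc p) (suc p)
to-even {k} {p} (indH , indV) h = record
  { evev = λ x y → trans (step-evev x y)
      (from-yes (∀-Bool? λ c → ∀-Bool? λ c' → ∀-Bool? λ e → ∀-Bool? λ w → ∀-Bool? λ n → ∀-Bool? λ s →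
          (c ∨ c') 𝔹.≟ c' →-dec (c' ∨ one4 e w n s) 𝔹.≟ c' →-dec
          (c' ∨ one4 (c ∨ e) (w ∨ c) (c ∨ n) (s ∨ c)) 𝔹.≟ c')
        (U p x y) (U (suc p) x y) _ _ _ _ (U-mono p x y) (U-closed p x y))
  ; odev = λ x y → trans (step-odev x y)
      (from-yes (∀-Bool? λ a → ∀-Bool? λ b → ∀-Bool? λ a' → ∀-Bool? λ b' →
          (a ∨ a') 𝔹.≟ a' →-dec (b ∨ b') 𝔹.≟ b' →-dec ((a' ∧ b') ∧ not (a ∨ b)) 𝔹.≟ false →-dec
          ((a ∨ b) ∨ one4 b' a' false false) 𝔹.≟ (a' ∨ b'))
        (U p x y) (U p (x +ℤ + 1) y) (U (suc p) x y) (U (suc p) (x +ℤ + 1) y)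
        (U-mono p x y) (U-mono p _ y) (indH x y))
  ; evod = λ x y → trans (step-evod x y)
      (from-yes (∀-Bool? λ a → ∀-Bool? λ b → ∀-Bool? λ a' → ∀-Bool? λ b' →
          (a ∨ a') 𝔹.≟ a' →-dec (b ∨ b') 𝔹.≟ b' →-dec ((a' ∧ b') ∧ not (a ∨ b)) 𝔹.≟ false →-dec
          ((a ∨ b) ∨ one4 false false b' a') 𝔹.≟ (a' ∨ b'))
        (U p x y) (U p x (y +ℤ + 1)) (U (suc p) x y) (U (suc p) x (y +ℤ + 1))
        (U-mono p x y) (U-mono p x _) (indV x y))
  ; odod = step-odod
  }
  where open Step h

-- Applied from stage 2p + 2 to 2p + 3. The midpoints around an OFF doubled cell show its neighbours
-- in U(p + 1), so it makes one step of U; a midpoint with an ON end is ON already.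
to-odd : ∀ {k p} → HalvesAt (suc k) (suc p) (suc p) → HalvesAt (suc (suc k)) (suc (suc p)) (suc p)
to-odd {k} {p} h = record
  { evev = λ x y → trans (step-evev x y)
      (from-yes (∀-Bool? λ c → ∀-Bool? λ e → ∀-Bool? λ w → ∀-Bool? λ n → ∀-Bool? λ s →
          (c ∨ one4 (c ∨ e) (w ∨ c) (c ∨ n) (s ∨ c)) 𝔹.≟ (c ∨ one4 e w n s))
        (U (suc p) x y) (U (suc p) (x +ℤ + 1) y) (U (suc p) (x -ℤ + 1) y)
        (U (suc p) x (y +ℤ + 1)) (U (suc p) x (y -ℤ + 1)))
  ; odev = λ x y → trans (step-odev x y)
      (from-yes (∀-Bool? λ a → ∀-Bool? λ b →
          ((a ∨ b) ∨ one4 b a false false) 𝔹.≟ (a ∨ b))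
        (U (suc p) x y) (U (suc p) (x +ℤ + 1) y))
  ; evod = λ x y → trans (step-evod x y)
      (from-yes (∀-Bool? λ a → ∀-Bool? λ b →
          ((a ∨ b) ∨ one4 false false b a) 𝔹.≟ (a ∨ b))
        (U (suc p) x y) (U (suc p) x (y +ℤ + 1)))
  ; odod = step-odod
  }
  where open Step h

Stable : ℕ → ℤ → ℤ → Set
Stable k x y = U (suc k) x y ≡ U k x y

stable⇒independent : ∀ k → (∀ x y → Stable k x y ⊎ Stable k (x +ℤ + 1) y) →
                     (∀ x y → Stable k x y ⊎ Stable k x (y +ℤ + 1)) → Independent k
stable⇒independent k h v = (λ x y → new _ _ _ _ (h x y)) , (λ x y → new _ _ _ _ (v x y))
  where
  new : ∀ a b a' b' → a' ≡ a ⊎ b' ≡ b → (a' ∧ b') ∧ not (a ∨ b) ≡ false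
  new a b a' b' (inj₁ refl) = from-yes
    (∀-Bool? λ a → ∀-Bool? λ b → ∀-Bool? λ b' → ((a ∧ b') ∧ not (a ∨ b)) 𝔹.≟ false) a b b'
  new a b a' b' (inj₂ refl) = from-yes
    (∀-Bool? λ a → ∀-Bool? λ b → ∀-Bool? λ a' → ((a' ∧ b) ∧ not (a ∨ b)) 𝔹.≟ false) a b a'

HalvesBoth : ℕ → Set
HalvesBoth p = HalvesAt (dbl p) p p × HalvesAt (suc (dbl p)) (suc p) p

-- Stage 2r + 1 changes only (even, even) cells and stage 2r + 2 only midpoints, and neither class
-- contains two neighbouring cells. The odd case compares the halvings at r and r + 1, hence the
-- bound by the ceiling.
independent : ∀ {k c f} → Halves k c f → (∀ {q} → q ≤ c → HalvesBoth q) → Independent k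
independent (even r) hs = stable⇒independent (dbl r) horizontal vertical
  where
  open HalvesAt
  h  = proj₁ (hs ℕ.≤-refl)
  h' = proj₂ (hs ℕ.≤-refl)

  odev-stable : ∀ x y → Stable (dbl r) (odℤ x) (evℤ y)
  odev-stable x y = trans (odev h' x y) (sym (odev h x y))

  evod-stable : ∀ x y → Stable (dbl r) (evℤ x) (odℤ y)
  evod-stable x y = trans (evod h' x y) (sym (evod h x y))

  odod-stable : ∀ x y → Stable (dbl r) (odℤ x) (odℤ y)
  odod-stable x y = trans (odod h' x y) (sym (odod h x y))

  horizontal : ∀ x y → Stable (dbl r) x y ⊎ Stable (dbl r) (x +ℤ + 1) y
  horizontal x y with parity x | parity y
  ... | ev x | ev y = inj₂ (subst (λ z → Stable (dbl r) z (evℤ y)) (sym (ev+1 x)) (odev-stable x y))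
  ... | od x | ev y = inj₁ (odev-stable x y)
  ... | ev x | od y = inj₁ (evod-stable x y)
  ... | od x | od y = inj₁ (odod-stable x y)

  vertical : ∀ x y → Stable (dbl r) x y ⊎ Stable (dbl r) x (y +ℤ + 1)
  vertical x y with parity x | parity y
  ... | ev x | ev y = inj₂ (subst (Stable (dbl r) (evℤ x)) (sym (ev+1 y)) (evod-stable x y))
  ... | od x | ev y = inj₁ (odev-stable x y)
  ... | ev x | od y = inj₁ (evod-stable x y)
  ... | od x | od y = inj₁ (odod-stable x y)
independent (odd r) hs = stable⇒independent (suc (dbl r)) horizontal vertical
  where
  open HalvesAt
  k  = suc (dbl r)
  h  = proj₂ (hs (ℕ.n≤1+n r))
  h' = proj₁ (hs ℕ.≤-refl)

  evev-stable : ∀ x y → Stable k (evℤ x) (evℤ y)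
  evev-stable x y = trans (evev h' x y) (sym (evev h x y))

  odod-stable : ∀ x y → Stable k (odℤ x) (odℤ y)
  odod-stable x y = trans (odod h' x y) (sym (odod h x y))

  horizontal : ∀ x y → Stable k x y ⊎ Stable k (x +ℤ + 1) y
  horizontal x y with parity x | parity y
  ... | ev x | ev y = inj₁ (evev-stable x y)
  ... | od x | ev y = inj₂ (subst (λ z → Stable k z (evℤ y)) (sym (od+1 x)) (evev-stable _ y))
  ... | ev x | od y = inj₂ (subst (λ z → Stable k z (odℤ y)) (sym (ev+1 x)) (odod-stable x y))
  ... | od x | od y = inj₁ (odod-stable x y)

  vertical : ∀ x y → Stable k x y ⊎ Stable k x (y +ℤ + 1)
  vertical x y with parity x | parity y
  ... | ev x | ev y = inj₁ (evev-stable x y)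
  ... | od x | ev y = inj₂ (subst (Stable k (odℤ x)) (sym (ev+1 y)) (odod-stable x y))
  ... | ev x | od y = inj₂ (subst (Stable k (evℤ x)) (sym (od+1 y)) (evev-stable x _))
  ... | od x | od y = inj₁ (odod-stable x y)

ceil≤ : ∀ {n c f} → Halves n c f → c ≤ n
ceil≤ (even m) = n≤dbl m
ceil≤ (odd m)  = s≤s (n≤dbl m)

-- Strong induction: the step to stage 2p + 2 needs independence at stage p, which follows from the
-- halvings up to the ceiling of p/2, and this is at most p.
halvesBoth : ∀ p → HalvesBoth p
halvesBoth = <-rec HalvesBoth go
  where
  go : ∀ p → (∀ {q} → q < p → HalvesBoth q) → HalvesBoth p
  go zero _ =
      record { evev = λ _ _ → refl ; odev = λ _ _ → refl ; evod = λ _ _ → refl ; odod = λ _ _ → refl }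
    , record { evev = evev₀ ; odev = odev₀ ; evod = evod₀ ; odod = odod₀ }
    where
    evev₀ : ∀ x y → U 1 (evℤ x) (evℤ y) ≡ U 1 x y
    evev₀ (+ zero)  (+ zero)  = refl
    evev₀ (+ zero)  (+ suc _) = refl
    evev₀ (+ zero)  -[1+ _ ]  = refl
    evev₀ (+ suc _) _         = refl
    evev₀ -[1+ _ ]  _         = refl

    odev₀ : ∀ x y → U 1 (odℤ x) (evℤ y) ≡ false
    odev₀ (+ _)    _ = refl
    odev₀ -[1+ _ ] _ = refl

    evod₀ : ∀ x y → U 1 (evℤ x) (odℤ y) ≡ false
    evod₀ x (+ _)    = 𝔹.∧-zeroʳ _
    evod₀ x -[1+ _ ] = 𝔹.∧-zeroʳ _

    odod₀ : ∀ x y → U 1 (odℤ x) (odℤ y) ≡ false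
    odod₀ (+ _)    _ = refl
    odod₀ -[1+ _ ] _ = refl
  go (suc p) rec = even-stage , to-odd even-stage
    where
    even-stage : HalvesAt (dbl (suc p)) (suc p) (suc p)
    even-stage with halves p
    ... | _ , _ , h = to-even (independent h (λ q≤c → rec (s≤s (ℕ.≤-trans q≤c (ceil≤ h)))))
                              (proj₂ (rec ℕ.≤-refl))

halvesAt : ∀ {n c f} → Halves n c f → HalvesAt n c f
halvesAt (even m) = proj₁ (halvesBoth m)
halvesAt (odd m)  = proj₂ (halvesBoth m)

U-independent : ∀ k → Independent k
U-independent k with halves k
... | _ , _ , h = independent h (λ {q} _ → halvesBoth q)

-- Sums over windows of the grid

-- The window is half open, -R ≤ x < R, so that the integers 2x and 2x + 1 for x in it fill exactly
-- the window of twice the radius.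
Σ₁ : ℕ → (ℤ → ℕ) → ℕ
Σ₁ zero    f = 0
Σ₁ (suc R) f = Σ₁ R f + (f (+ R) + f -[1+ R ])

Σ₁-cong : ∀ R {f g} → (∀ x → f x ≡ g x) → Σ₁ R f ≡ Σ₁ R g
Σ₁-cong zero    e = refl
Σ₁-cong (suc R) e = cong₂ _+_ (Σ₁-cong R e) (cong₂ _+_ (e _) (e _))

Σ₁-zero : ∀ R → Σ₁ R (λ _ → 0) ≡ 0
Σ₁-zero zero    = refl
Σ₁-zero (suc R) = trans (ℕ.+-identityʳ _) (Σ₁-zero R)

Σ₁-+ : ∀ R f g → Σ₁ R (λ x → f x + g x) ≡ Σ₁ R f + Σ₁ R g
Σ₁-+ zero    f g = refl
Σ₁-+ (suc R) f g rewrite Σ₁-+ R f g = 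
  shuffle (Σ₁ R f) (Σ₁ R g) (f (+ R)) (g (+ R)) (f -[1+ R ]) (g -[1+ R ])
  where
  shuffle : ∀ a b c d e f → (a + b) + ((c + d) + (e + f)) ≡ (a + (c + e)) + (b + (d + f))
  shuffle = ℕRing.solve-∀

Σ₁-dbl : ∀ R f → Σ₁ (dbl R) f ≡ Σ₁ R (λ x → f (evℤ x) + f (odℤ x))
Σ₁-dbl zero    f = refl
Σ₁-dbl (suc R) f rewrite Σ₁-dbl R f = 
  shuffle (Σ₁ R (λ x → f (evℤ x) + f (odℤ x)))
    (f (+ dbl R)) (f -[1+ dbl R ]) (f (+ suc (dbl R))) (f -[1+ suc (dbl R) ])
  where
  shuffle : ∀ s a b c d → (s + (a + b)) + (c + d) ≡ s + ((a + c) + (d + b))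
  shuffle = ℕRing.solve-∀

-- The shifted window loses the point -R and gains R; the two terms stand on opposite sides to avoid
-- subtraction in ℕ.
Σ₁-shift : ∀ R f → Σ₁ R (λ x → f (x +ℤ + 1)) + f (- + R) ≡ Σ₁ R f + f (+ R)
Σ₁-shift zero    f = refl
Σ₁-shift (suc R) f = begin
  (Σ₁ R f⁺ + (f (+ R +ℤ + 1) + f (-[1+ R ] +ℤ + 1))) + f -[1+ R ]
    ≡⟨ cong₂ (λ a b → (Σ₁ R f⁺ + (f a + f b)) + f -[1+ R ]) (cong +_ (ℕ.+-comm R 1)) (up R) ⟩
  (Σ₁ R f⁺ + (f (+ suc R) + f (- + R))) + f -[1+ R ]
    ≡⟨ shuffle₁ (Σ₁ R f⁺) _ _ _ ⟩
  (Σ₁ R f⁺ + f (- + R)) + (f (+ suc R) + f -[1+ R ])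
    ≡⟨ cong (_+ (f (+ suc R) + f -[1+ R ])) (Σ₁-shift R f) ⟩
  (Σ₁ R f + f (+ R)) + (f (+ suc R) + f -[1+ R ])
    ≡⟨ shuffle₂ (Σ₁ R f) _ _ _ ⟩
  (Σ₁ R f + (f (+ R) + f -[1+ R ])) + f (+ suc R) ∎
  where
  open ≡-Reasoning
  f⁺ : ℤ → ℕ
  f⁺ x = f (x +ℤ + 1)
  up : ∀ R → -[1+ R ] +ℤ + 1 ≡ - + R
  up zero    = refl
  up (suc R) = refl
  shuffle₁ : ∀ s a b c → (s + (a + b)) + c ≡ (s + b) + (a + c)
  shuffle₁ = ℕRing.solve-∀
  shuffle₂ : ∀ s a b c → (s + a) + (b + c) ≡ (s + (a + c)) + b
  shuffle₂ = ℕRing.solve-∀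

Σ₁-extend : ∀ {r R} f → (∀ x → r ≤ ∣ x ∣ → f x ≡ 0) → r ≤ R → Σ₁ R f ≡ Σ₁ r f
Σ₁-extend {zero} {zero} f z r≤R = refl
Σ₁-extend {r} {suc R} f z r≤R with ℕ.m≤n⇒m<n∨m≡n r≤R
... | inj₂ refl = refl
... | inj₁ (s≤s r≤R')
  rewrite z (+ R) r≤R' | z -[1+ R ] r≤R = trans (ℕ.+-identityʳ _) (Σ₁-extend f z r≤R')

Σ₂ : ℕ → (ℤ → ℤ → ℕ) → ℕ
Σ₂ R f = Σ₁ R (λ x → Σ₁ R (f x))

-- The inequalities are weak so that both -R and R count as outside: a function supported in radius
-- R then loses nothing when shifted by one.
Outside : ℕ → ℤ → ℤ → Set
Outside r x y = r ≤ ∣ x ∣ ⊎ r ≤ ∣ y ∣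

Supported : ℕ → (ℤ → ℤ → ℕ) → Set
Supported r f = ∀ x y → Outside r x y → f x y ≡ 0

Σ₂-cong : ∀ R {f g} → (∀ x y → f x y ≡ g x y) → Σ₂ R f ≡ Σ₂ R g
Σ₂-cong R e = Σ₁-cong R (λ x → Σ₁-cong R (e x))

Σ₂-+ : ∀ R f g → Σ₂ R (λ x y → f x y + g x y) ≡ Σ₂ R f + Σ₂ R g
Σ₂-+ R f g = trans (Σ₁-cong R (λ x → Σ₁-+ R (f x) (g x))) (Σ₁-+ R _ _)

Σ₂-dbl : ∀ R f → Σ₂ (dbl R) f ≡
  Σ₂ R (λ x y → (f (evℤ x) (evℤ y) + f (evℤ x) (odℤ y)) + (f (odℤ x) (evℤ y) + f (odℤ x) (odℤ y)))
Σ₂-dbl R f = trans (Σ₁-dbl R _) (Σ₁-cong R λ x →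
  trans (cong₂ _+_ (Σ₁-dbl R (f (evℤ x))) (Σ₁-dbl R (f (odℤ x)))) (sym (Σ₁-+ R _ _)))

Σ₂-extend : ∀ {r R f} → Supported r f → r ≤ R → Σ₂ R f ≡ Σ₂ r f
Σ₂-extend {r} {R} {f} z r≤R = trans
  (Σ₁-cong R (λ x → Σ₁-extend (f x) (λ y r≤y → z x y (inj₂ r≤y)) r≤R))
  (Σ₁-extend _ (λ x r≤x → trans (Σ₁-cong r (λ y → z x y (inj₁ r≤x))) (Σ₁-zero r)) r≤R)

∣-+∣ : ∀ R → ∣ - + R ∣ ≡ R
∣-+∣ R = ℤ.∣-i∣≡∣i∣ (+ R)

Σ₁-shift-supported : ∀ {r R} f → (∀ x → r ≤ ∣ x ∣ → f x ≡ 0) → r ≤ R →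
                     Σ₁ R (λ x → f (x +ℤ + 1)) ≡ Σ₁ R f
Σ₁-shift-supported {r} {R} f z r≤R = begin
  Σ₁ R (λ x → f (x +ℤ + 1))             ≡⟨ ℕ.+-identityʳ _ ⟨
  Σ₁ R (λ x → f (x +ℤ + 1)) + 0         ≡⟨ cong (_+_ (Σ₁ R (λ x → f (x +ℤ + 1))))
                                              (z (- + R) (subst (r ≤_) (sym (∣-+∣ R)) r≤R)) ⟨
  Σ₁ R (λ x → f (x +ℤ + 1)) + f (- + R) ≡⟨ Σ₁-shift R f ⟩
  Σ₁ R f + f (+ R)                      ≡⟨ cong (_+_ (Σ₁ R f)) (z (+ R) r≤R) ⟩
  Σ₁ R f + 0                            ≡⟨ ℕ.+-identityʳ _ ⟩
  Σ₁ R f                                ∎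
  where open ≡-Reasoning

Σ₂-shift-x : ∀ {r R f} → Supported r f → r ≤ R → Σ₂ R (λ x y → f (x +ℤ + 1) y) ≡ Σ₂ R f
Σ₂-shift-x {r} {R} z r≤R = Σ₁-shift-supported _
  (λ x r≤x → trans (Σ₁-cong R (λ y → z x y (inj₁ r≤x))) (Σ₁-zero R)) r≤R

Σ₂-shift-y : ∀ {r R f} → Supported r f → r ≤ R → Σ₂ R (λ x y → f x (y +ℤ + 1)) ≡ Σ₂ R f
Σ₂-shift-y {R = R} {f} z r≤R =
  Σ₁-cong R (λ x → Σ₁-shift-supported (f x) (λ y r≤y → z x y (inj₂ r≤y)) r≤R)

sum-range : ∀ f r → sum (map f (range r)) ≡ Σ₁ r f + f (+ r)
sum-range f r = begin
  sum (map f (map (λ i → + i -ℤ + r) (upTo (suc (r + r)))))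
    ≡⟨ cong sum (List.map-∘ (upTo (suc (r + r)))) ⟨
  sum (map (λ i → f (+ i -ℤ + r)) (upTo (suc (r + r))))
    ≡⟨ cong sum (List.map-upTo _ (suc (r + r))) ⟩
  sum (applyUpTo (λ i → f (+ i -ℤ + r)) (suc (r + r)))
    -- Splits the indices into `r` for the negative integers and `suc r` for those from 0 to r.
    ≡⟨ cong (λ k → sum (applyUpTo (λ i → f (+ i -ℤ + r)) k)) (ℕ.+-suc r r) ⟨
  sum (applyUpTo (λ i → f (+ i -ℤ + r)) (r + suc r))
    ≡⟨ from-left r (suc r) ⟩
  neg r + sum (applyUpTo (f ∘ +_) (suc r))
    ≡⟨ cong (_+_ (neg r)) (pos (suc r)) ⟩
  neg r + (Σ⁺ r + f (+ r))
    ≡⟨ ℕ.+-assoc (neg r) _ _ ⟨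
  (neg r + Σ⁺ r) + f (+ r)
    ≡⟨ cong (_+ f (+ r)) (merge r) ⟩
  Σ₁ r f + f (+ r) ∎
  where
  open ≡-Reasoning
  neg Σ⁺ : ℕ → ℕ
  neg zero    = 0
  neg (suc r) = f -[1+ r ] + neg r
  Σ⁺ zero    = 0
  Σ⁺ (suc r) = Σ⁺ r + f (+ r)

  shift-index : ∀ r i → + suc i -ℤ + suc r ≡ + i -ℤ + r
  shift-index r i = trans (ℤ.m-n≡m⊖n (suc i) (suc r))
    (trans (ℤ.[1+m]⊖[1+n]≡m⊖n i r) (sym (ℤ.m-n≡m⊖n i r)))

  applyUpTo-cong : ∀ {g h : ℕ → ℕ} → (∀ i → g i ≡ h i) → ∀ k → applyUpTo g k ≡ applyUpTo h k
  applyUpTo-cong e zero    = refl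
  applyUpTo-cong e (suc k) = cong₂ _∷_ (e 0) (applyUpTo-cong (e ∘ suc) k)

  from-left : ∀ r k → sum (applyUpTo (λ i → f (+ i -ℤ + r)) (r + k)) ≡ neg r + sum (applyUpTo (f ∘ +_) k)
  from-left zero    k = cong sum (applyUpTo-cong (λ i → cong f (ℤ.+-identityʳ (+ i))) k)
  from-left (suc r) k = trans
    (cong (λ l → f -[1+ r ] + sum l) (applyUpTo-cong (λ i → cong f (shift-index r i)) (r + k)))
    (trans (cong (_+_ (f -[1+ r ])) (from-left r k)) (sym (ℕ.+-assoc (f -[1+ r ]) _ _)))

  pos : ∀ k → sum (applyUpTo (f ∘ +_) k) ≡ Σ⁺ k
  pos zero    = refl
  pos (suc k) = begin
    sum (applyUpTo (f ∘ +_) (suc k))               ≡⟨ cong sum (List.applyUpTo-∷ʳ (f ∘ +_) k) ⟨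
    sum (applyUpTo (f ∘ +_) k ++ (f (+ k) ∷ []))   ≡⟨ sum-++ (applyUpTo (f ∘ +_) k) _ ⟩
    sum (applyUpTo (f ∘ +_) k) + (f (+ k) + 0)     ≡⟨ cong₂ _+_ (pos k) (ℕ.+-identityʳ _) ⟩
    Σ⁺ k + f (+ k)                                 ∎

  merge : ∀ r → neg r + Σ⁺ r ≡ Σ₁ r f
  merge zero    = refl
  merge (suc r) = trans (shuffle (f -[1+ r ]) (neg r) (Σ⁺ r) (f (+ r)))
                        (cong (_+ (f (+ r) + f -[1+ r ])) (merge r))
    where
    shuffle : ∀ a b c d → (a + b) + (c + d) ≡ (b + c) + (d + a)
    shuffle = ℕRing.solve-∀

sum-concatMap : ∀ {A : Set} (g : A → List ℕ) xs → sum (concatMap g xs) ≡ sum (map (sum ∘ g) xs)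
sum-concatMap g []       = refl
sum-concatMap g (x ∷ xs) = trans (sum-++ (g x) _) (cong (_+_ (sum (g x))) (sum-concatMap g xs))

newCount≡Σ₂ : ∀ rule n → Supported n (λ x y → b2n (turnedOn rule n x y)) →
              newCount rule n ≡ Σ₂ n (λ x y → b2n (turnedOn rule n x y))
newCount≡Σ₂ rule n z = begin
  newCount rule n
    ≡⟨ sum-concatMap (λ x → map (f x) (range n)) (range n) ⟩
  sum (map (λ x → sum (map (f x) (range n))) (range n))
    ≡⟨ sum-range (λ x → sum (map (f x) (range n))) n ⟩
  Σ₁ n (λ x → sum (map (f x) (range n))) + sum (map (f (+ n)) (range n))
    ≡⟨ cong₂ _+_ (Σ₁-cong n inner) (trans (inner (+ n))
         (trans (Σ₁-cong n (λ y → z (+ n) y (inj₁ ℕ.≤-refl))) (Σ₁-zero n))) ⟩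
  Σ₂ n f + 0
    ≡⟨ ℕ.+-identityʳ _ ⟩
  Σ₂ n f ∎
  where
  open ≡-Reasoning
  f : ℤ → ℤ → ℕ
  f x y = b2n (turnedOn rule n x y)
  inner : ∀ x → sum (map (f x) (range n)) ≡ Σ₁ n (f x)
  inner x = trans (sum-range (f x) n)
    (trans (cong (_+_ (Σ₁ n (f x))) (z x (+ n) (inj₂ ℕ.≤-refl))) (ℕ.+-identityʳ _))

-- Counting along the halving

∣x∣≤1+∣x+1∣ : ∀ x → ∣ x ∣ ≤ suc ∣ x +ℤ + 1 ∣
∣x∣≤1+∣x+1∣ x = subst₂ _≤_ (cong ∣_∣ (x+1-1 x)) (ℕ.+-comm _ 1) (ℤ.∣i-j∣≤∣i∣+∣j∣ (x +ℤ + 1) (+ 1))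

∣x∣≤1+∣x-1∣ : ∀ x → ∣ x ∣ ≤ suc ∣ x -ℤ + 1 ∣
∣x∣≤1+∣x-1∣ x = subst₂ _≤_ (cong ∣_∣ (x-1+1 x)) (ℕ.+-comm _ 1) (ℤ.∣i+j∣≤∣i∣+∣j∣ (x -ℤ + 1) (+ 1))

-- ON cells spread by at most one step per stage: a neighbour of a cell outside radius `suc r` is
-- outside radius `r`.
U-outside : ∀ n x y → Outside n x y → U n x y ≡ false
U-outside zero    x        y        o = refl
U-outside (suc zero) (+ suc _) y    o = refl
U-outside (suc zero) -[1+ _ ] y     o = refl
U-outside (suc zero) (+ zero) (+ suc _) o = refl
U-outside (suc zero) (+ zero) -[1+ _ ]  o = refl
U-outside (suc zero) (+ zero) (+ zero) (inj₁ ())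
U-outside (suc zero) (+ zero) (+ zero) (inj₂ ())
U-outside (suc (suc k)) x y o =
  U-step k (U-outside (suc k) x y (narrow o (ℕ.n≤1+n _) (ℕ.n≤1+n _)))
    (U-outside (suc k) _ y (narrow o (∣x∣≤1+∣x+1∣ x) (ℕ.n≤1+n _)))
    (U-outside (suc k) _ y (narrow o (∣x∣≤1+∣x-1∣ x) (ℕ.n≤1+n _)))
    (U-outside (suc k) x _ (narrow o (ℕ.n≤1+n _) (∣x∣≤1+∣x+1∣ y)))
    (U-outside (suc k) x _ (narrow o (ℕ.n≤1+n _) (∣x∣≤1+∣x-1∣ y)))
  where
  narrow : ∀ {r a b a' b'} → suc r ≤ a ⊎ suc r ≤ b → a ≤ suc a' → b ≤ suc b' → r ≤ a' ⊎ r ≤ b'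
  narrow (inj₁ p) a≤ _ = inj₁ (ℕ.s≤s⁻¹ (ℕ.≤-trans p a≤))
  narrow (inj₂ p) _ b≤ = inj₂ (ℕ.s≤s⁻¹ (ℕ.≤-trans p b≤))

all4 : Bool → Bool → Bool → Bool → Bool
all4 e w n s = (e ∧ w) ∧ (n ∧ s)

nbrs : (Bool → Bool → Bool → Bool → Bool) → ℕ → ℤ → ℤ → Bool
nbrs g k x y = g (U k (x +ℤ + 1) y) (U k (x -ℤ + 1) y) (U k x (y +ℤ + 1)) (U k x (y -ℤ + 1))

Hole : ℕ → ℤ → ℤ → Bool
Hole k x y = not (U k x y) ∧ nbrs all4 k x y

-- On the unit square with lower left corner (x , y), in the order a, b on the lower side
-- and c, d on the upper side.
onSquare : (Bool → Bool → Bool → Bool → ℕ) → ℕ → ℤ → ℤ → ℕ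
onSquare g k x y = g (U k x y) (U k (x +ℤ + 1) y) (U k x (y +ℤ + 1)) (U k (x +ℤ + 1) (y +ℤ + 1))

diagonal corners : Bool → Bool → Bool → Bool → ℕ
diagonal a b c d = b2n ((a ∧ d) ∨ (b ∧ c))
corners a b c d = (b2n (not a ∧ (b ∧ c)) + b2n (not d ∧ (b ∧ c)))
                + (b2n (not b ∧ (a ∧ d)) + b2n (not c ∧ (a ∧ d)))

-- `pair` looks only to the right and upwards, so its total counts each edge between two ON cells
-- once; `square` counts a unit square once even if both diagonals are ON.
cell hole square corner pair : ℕ → ℤ → ℤ → ℕ
cell k x y = b2n (U k x y)
hole k x y = b2n (Hole k x y)
square     = onSquare diagonal
corner     = onSquare corners
pair k x y = b2n (U k x y ∧ U k (x +ℤ + 1) y) + b2n (U k x y ∧ U k x (y +ℤ + 1))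

total : (ℕ → ℤ → ℤ → ℕ) → ℕ → ℕ
total F n = Σ₂ n (F n)

LocallySupported : (ℕ → ℤ → ℤ → ℕ) → Set
LocallySupported F = ∀ n → Supported n (F n)

cell-supported : LocallySupported cell
cell-supported n x y o = cong b2n (U-outside n x y o)

-- A step away from the origin stays outside. So a cell outside has an OFF neighbour and cannot be a
-- hole.
outside-neighbour : ∀ n x y → Outside n x y →
  (Outside n (x +ℤ + 1) y ⊎ Outside n (x -ℤ + 1) y) ⊎ (Outside n x (y +ℤ + 1) ⊎ Outside n x (y -ℤ + 1))
outside-neighbour n (+ i)    y (inj₁ p) = inj₁ (inj₁ (inj₁ (ℕ.≤-trans p (ℕ.m≤m+n i 1))))
outside-neighbour n -[1+ i ] y (inj₁ p) = inj₁ (inj₂ (inj₁ (ℕ.≤-trans p (s≤s (ℕ.m≤n⇒m≤1+n (ℕ.m≤m+n i 0))))))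
outside-neighbour n x (+ i)    (inj₂ p) = inj₂ (inj₁ (inj₂ (ℕ.≤-trans p (ℕ.m≤m+n i 1))))
outside-neighbour n x -[1+ i ] (inj₂ p) = inj₂ (inj₂ (inj₂ (ℕ.≤-trans p (s≤s (ℕ.m≤n⇒m≤1+n (ℕ.m≤m+n i 0))))))

Hole-outside : ∀ n x y → Outside n x y → Hole n x y ≡ false
Hole-outside n x y o with outside-neighbour n x y o
... | inj₁ (inj₁ o') rewrite U-outside n (x +ℤ + 1) y o' = 𝔹.∧-zeroʳ _
... | inj₁ (inj₂ o') rewrite U-outside n (x -ℤ + 1) y o' | 𝔹.∧-zeroʳ (U n (x +ℤ + 1) y) = 𝔹.∧-zeroʳ _
... | inj₂ (inj₁ o') rewrite U-outside n x (y +ℤ + 1) o'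
                           | 𝔹.∧-zeroʳ (U n (x +ℤ + 1) y ∧ U n (x -ℤ + 1) y) = 𝔹.∧-zeroʳ _
... | inj₂ (inj₂ o') rewrite U-outside n x (y -ℤ + 1) o' | 𝔹.∧-zeroʳ (U n x (y +ℤ + 1))
                           | 𝔹.∧-zeroʳ (U n (x +ℤ + 1) y ∧ U n (x -ℤ + 1) y) = 𝔹.∧-zeroʳ _

hole-supported : LocallySupported hole
hole-supported n x y o = cong b2n (Hole-outside n x y o)

onSquare-supported : ∀ g → (∀ b d → g false b false d ≡ 0) → (∀ c d → g false false c d ≡ 0) →
                     LocallySupported (onSquare g)
onSquare-supported g left lower n x y (inj₁ p)
  rewrite U-outside n x y (inj₁ p) | U-outside n x (y +ℤ + 1) (inj₁ p) = left _ _
onSquare-supported g left lower n x y (inj₂ p)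
  rewrite U-outside n x y (inj₂ p) | U-outside n (x +ℤ + 1) y (inj₂ p) = lower _ _

square-supported : LocallySupported square
square-supported = onSquare-supported diagonal
  (from-yes (∀-Bool? λ b → ∀-Bool? λ d → diagonal false b false d ℕ.≟ 0))
  (from-yes (∀-Bool? λ c → ∀-Bool? λ d → diagonal false false c d ℕ.≟ 0))

corner-supported : LocallySupported corner
corner-supported = onSquare-supported corners
  (from-yes (∀-Bool? λ b → ∀-Bool? λ d → corners false b false d ℕ.≟ 0))
  (from-yes (∀-Bool? λ c → ∀-Bool? λ d → corners false false c d ℕ.≟ 0))

pair-supported : LocallySupported pair
pair-supported n x y o rewrite U-outside n x y o = refl

many : Bool → Bool → Bool → Bool → Bool
many e w n s = 2 ℕ.≤ᵇ (b2n e + b2n w + b2n n + b2n s)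

-- Only cells with exactly one ON neighbour are turned ON, so two or more ON neighbours exclude a
-- cell from the next stage.
blocked : ∀ k x y → (U (suc k) x y ∧ not (U k x y)) ∧ nbrs many k x y ≡ false
blocked zero    x y = 𝔹.∧-zeroʳ _
blocked (suc k) x y = from-yes
  (∀-Bool? λ c → ∀-Bool? λ e → ∀-Bool? λ w → ∀-Bool? λ n → ∀-Bool? λ s →
    (((c ∨ one4 e w n s) ∧ not c) ∧ many e w n s) 𝔹.≟ false)
  (U (suc k) x y) (U (suc k) (x +ℤ + 1) y) (U (suc k) (x -ℤ + 1) y)
  (U (suc k) x (y +ℤ + 1)) (U (suc k) x (y -ℤ + 1))

stage≤ : ∀ {n c f} → Halves n c f → n ≤ dbl (suc f)
stage≤ (even m) = ℕ.m≤n⇒m≤1+n (ℕ.n≤1+n _)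
stage≤ (odd m)  = ℕ.n≤1+n _

ceil≤1+floor : ∀ {n c f} → Halves n c f → c ≤ suc f
ceil≤1+floor (even m) = ℕ.n≤1+n m
ceil≤1+floor (odd m)  = ℕ.≤-refl

blocks : (ℤ → ℤ → ℕ) → ℤ → ℤ → ℕ
blocks F x y = (F (evℤ x) (evℤ y) + F (evℤ x) (odℤ y)) + (F (odℤ x) (evℤ y) + F (odℤ x) (odℤ y))

total-dbl : ∀ {F n c f} → LocallySupported F → Halves n c f →
            total F n ≡ Σ₂ (suc f) (blocks (F n))
total-dbl {F} {n} {f = f} z h = trans (sym (Σ₂-extend (z n) (stage≤ h))) (Σ₂-dbl (suc f) (F n))

total-blocks : ∀ {F n c f} G → LocallySupported F → Halves n c f → (∀ x y → blocks (F n) x y ≡ G x y) →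
               total F n ≡ Σ₂ (suc f) G
total-blocks {f = f} G z h e = trans (total-dbl z h) (Σ₂-cong (suc f) e)

total-wide : ∀ {F n} R → LocallySupported F → n ≤ R → Σ₂ R (F n) ≡ total F n
total-wide R z n≤R = Σ₂-extend (z _) n≤R

mono-halves : ∀ {n c f} → Halves n c f → ∀ x y → U f x y ∨ U c x y ≡ U c x y
mono-halves (even m) x y = 𝔹.∨-idem _
mono-halves (odd m)  x y = U-mono m x y

blocked-halves : ∀ {n c f} → Halves n c f → ∀ x y → (U c x y ∧ not (U f x y)) ∧ nbrs many f x y ≡ false
blocked-halves (even m) x y rewrite 𝔹.∧-inverseʳ (U m x y) = refl
blocked-halves (odd m)  x y = blocked m x y

-- By parity: the holes at (even, even) cells are those of stage `f`, a midpoint has an OFF (odd,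
-- odd) neighbour and is never a hole, and the holes at (odd, odd) cells are the squares of stage
-- `f`.
hole-rec : ∀ {n c f} → Halves n c f → total hole n ≡ total hole f + total square f
hole-rec {n} {c} {f} h = begin
  total hole n
    ≡⟨ total-blocks (λ x y → hole f x y + square f x y) hole-supported h pointwise ⟩
  Σ₂ (suc f) (λ x y → hole f x y + square f x y)
    ≡⟨ Σ₂-+ (suc f) (hole f) (square f) ⟩
  Σ₂ (suc f) (hole f) + Σ₂ (suc f) (square f)
    ≡⟨ cong₂ _+_ (total-wide _ hole-supported (ℕ.n≤1+n f)) (total-wide _ square-supported (ℕ.n≤1+n f)) ⟩
  total hole f + total square f ∎
  where
  open ≡-Reasoning
  open HalvesAt (halvesAt h)

  holeB : Bool → Bool → Bool → Bool → Bool → ℕ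
  holeB c e w n s = b2n (not c ∧ all4 e w n s)

  hole≡ : ∀ {x y c' e w n' s} → U n x y ≡ c' → U n (x +ℤ + 1) y ≡ e → U n (x -ℤ + 1) y ≡ w →
          U n x (y +ℤ + 1) ≡ n' → U n x (y -ℤ + 1) ≡ s → hole n x y ≡ holeB c' e w n' s
  hole≡ refl refl refl refl refl = refl

  at-evev : ∀ x y → hole n (evℤ x) (evℤ y) ≡ hole f x y
  at-evev x y = trans (hole≡ (evev x y) (odev+ x y) (odev- x y) (evod+ x y) (evod- x y))
    -- If the cell is OFF in stage `f`, its midpoints show its neighbours there; four ON neighbours
    -- block it, so it is OFF in stage `c` too.
    (from-yes (∀-Bool? λ c' → ∀-Bool? λ c → ∀-Bool? λ e → ∀-Bool? λ w → ∀-Bool? λ n → ∀-Bool? λ s →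
        ((c' ∧ not c) ∧ many e w n s) 𝔹.≟ false →-dec (c ∨ c') 𝔹.≟ c' →-dec
        holeB c' (c ∨ e) (w ∨ c) (c ∨ n) (s ∨ c) ℕ.≟ holeB c e w n s)
      (U c x y) (U f x y) (U f (x +ℤ + 1) y) (U f (x -ℤ + 1) y) (U f x (y +ℤ + 1)) (U f x (y -ℤ + 1))
      (blocked-halves h x y) (mono-halves h x y))

  at-evod : ∀ x y → hole n (evℤ x) (odℤ y) ≡ 0
  at-evod x y = trans (hole≡ refl (trans (cong (λ z → U n z (odℤ y)) (ev+1 x)) (odod x y)) refl refl refl)
    (cong b2n (𝔹.∧-zeroʳ _))

  at-odev : ∀ x y → hole n (odℤ x) (evℤ y) ≡ 0
  at-odev x y = trans
    (hole≡ refl refl refl (trans (cong (U n (odℤ x)) (ev+1 y)) (odod x y)) refl)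
    (from-yes (∀-Bool? λ c → ∀-Bool? λ e → ∀-Bool? λ w → ∀-Bool? λ s → holeB c e w false s ℕ.≟ 0)
      (U n (odℤ x) (evℤ y)) (U n (odℤ x +ℤ + 1) (evℤ y)) (U n (odℤ x -ℤ + 1) (evℤ y))
      (U n (odℤ x) (evℤ y -ℤ + 1)))

  -- Each side of the unit square has an ON endpoint exactly when a diagonal is ON.
  at-odod : ∀ x y → hole n (odℤ x) (odℤ y) ≡ square f x y
  at-odod x y = trans
    (hole≡ (odod x y)
      (trans (cong (λ z → U n z (odℤ y)) (od+1 x)) (evod _ y))
      (trans (cong (λ z → U n z (odℤ y)) (od-1 x)) (evod x y))
      (trans (cong (U n (odℤ x)) (od+1 y)) (odev x _))
      (trans (cong (U n (odℤ x)) (od-1 y)) (odev x y)))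
    (from-yes (∀-Bool? λ a → ∀-Bool? λ b → ∀-Bool? λ c → ∀-Bool? λ d →
        holeB false (b ∨ d) (a ∨ c) (c ∨ d) (a ∨ b) ℕ.≟ diagonal a b c d)
      (U f x y) (U f (x +ℤ + 1) y) (U f x (y +ℤ + 1)) (U f (x +ℤ + 1) (y +ℤ + 1)))

  pointwise : ∀ x y → blocks (hole n) x y ≡ hole f x y + square f x y
  pointwise x y rewrite at-evev x y | at-evod x y | at-odev x y | at-odod x y =
    cong (_+ square f x y) (ℕ.+-identityʳ (hole f x y))

-- Doubling cuts a unit square into four parts, each with one original vertex at stage `c` (primed),
-- two midpoints and the centre, which is always OFF.
squareBlocks : (Bool → Bool → Bool → Bool → ℕ) → (a' b' c' d' a b c d : Bool) → ℕ
squareBlocks g a' b' c' d' a b c d =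
    (g a' (a ∨ b) (a ∨ c) false + g (a ∨ c) false c' (c ∨ d))
  + (g (a ∨ b) b' false (b ∨ d) + g false (b ∨ d) (c ∨ d) d')

onSquare-blocks : ∀ g {n c f} → Halves n c f → ∀ x y → blocks (onSquare g n) x y ≡
  squareBlocks g (U c x y) (U c (x +ℤ + 1) y) (U c x (y +ℤ + 1)) (U c (x +ℤ + 1) (y +ℤ + 1))
                 (U f x y) (U f (x +ℤ + 1) y) (U f x (y +ℤ + 1)) (U f (x +ℤ + 1) (y +ℤ + 1))
onSquare-blocks g h x y
  rewrite ev+1 x | ev+1 y | od+1 x | od+1 y
        | HalvesAt.evev (halvesAt h) x y | HalvesAt.evev (halvesAt h) (x +ℤ + 1) y
        | HalvesAt.evev (halvesAt h) x (y +ℤ + 1) | HalvesAt.evev (halvesAt h) (x +ℤ + 1) (y +ℤ + 1)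
        | HalvesAt.odev (halvesAt h) x y | HalvesAt.odev (halvesAt h) x (y +ℤ + 1)
        | HalvesAt.evod (halvesAt h) x y | HalvesAt.evod (halvesAt h) (x +ℤ + 1) y
        | HalvesAt.odod (halvesAt h) x y = refl

-- In each of the four parts only the diagonal joining two midpoints can be ON. For the part at `a`
-- this means (a or b) and (a or c): either `a` is ON, or it is an OFF corner between ON corners.
-- Each cell is a vertex of four squares, hence the factor 4.
square-rec : ∀ {n c f} → Halves n c f → total square n ≡ 4 * total cell f + total corner f
square-rec {n} {c} {f} h = begin
  total square n
    ≡⟨ total-blocks (λ x y → vertices x y + corner f x y) square-supported h pointwise ⟩
  Σ₂ R (λ x y → vertices x y + corner f x y)
    ≡⟨ Σ₂-+ R vertices (corner f) ⟩
  Σ₂ R vertices + Σ₂ R (corner f)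
    ≡⟨ cong₂ _+_ vertex-count (total-wide R corner-supported f≤R) ⟩
  4 * total cell f + total corner f ∎
  where
  open ≡-Reasoning
  R = suc f
  f≤R = ℕ.n≤1+n f
  cell→ cell↑ cell↗ vertices : ℤ → ℤ → ℕ
  cell→ x y = cell f (x +ℤ + 1) y
  cell↑ x y = cell f x (y +ℤ + 1)
  cell↗ x y = cell f (x +ℤ + 1) (y +ℤ + 1)
  vertices x y = (cell f x y + cell→ x y) + (cell↑ x y + cell↗ x y)

  pointwise : ∀ x y → blocks (square n) x y ≡ vertices x y + corner f x y
  pointwise x y = trans (onSquare-blocks diagonal h x y)
    (from-yes (∀-Bool? λ a → ∀-Bool? λ b → ∀-Bool? λ c → ∀-Bool? λ d →
               ∀-Bool? λ a' → ∀-Bool? λ b' → ∀-Bool? λ c' → ∀-Bool? λ d' →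
        squareBlocks diagonal a' b' c' d' a b c d ℕ.≟
        (b2n a + b2n b + (b2n c + b2n d)) + corners a b c d)
      (U f x y) (U f (x +ℤ + 1) y) (U f x (y +ℤ + 1)) (U f (x +ℤ + 1) (y +ℤ + 1))
      (U c x y) (U c (x +ℤ + 1) y) (U c x (y +ℤ + 1)) (U c (x +ℤ + 1) (y +ℤ + 1)))

  here : Σ₂ R (cell f) ≡ total cell f
  here = total-wide R cell-supported f≤R

  up : Σ₂ R cell↑ ≡ total cell f
  up = trans (Σ₂-shift-y (cell-supported f) f≤R) here

  four : ∀ n → (n + n) + (n + n) ≡ 4 * n
  four = ℕRing.solve-∀

  vertex-count : Σ₂ R vertices ≡ 4 * total cell f
  vertex-count = begin
    Σ₂ R vertices
      ≡⟨ trans (Σ₂-+ R _ _) (cong₂ _+_ (Σ₂-+ R _ _) (Σ₂-+ R _ _)) ⟩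
    (Σ₂ R (cell f) + Σ₂ R cell→) + (Σ₂ R cell↑ + Σ₂ R cell↗)
      ≡⟨ cong₂ _+_
           (cong₂ _+_ here (trans (Σ₂-shift-x (cell-supported f) f≤R) here))
           (cong₂ _+_ up (trans (Σ₂-shift-x {r = R} cell↑-supported ℕ.≤-refl) up)) ⟩
    (total cell f + total cell f) + (total cell f + total cell f)
      ≡⟨ four (total cell f) ⟩
    4 * total cell f ∎
    where
    cell↑-supported : Supported R cell↑
    cell↑-supported x y (inj₁ p) = cell-supported f x _ (inj₁ (ℕ.≤-trans f≤R p))
    cell↑-supported x y (inj₂ p) = cell-supported f x _ (inj₂ (ℕ.s≤s⁻¹ (ℕ.≤-trans p (∣x∣≤1+∣x+1∣ y))))

-- A midpoint is never counted, being adjacent to the OFF centre in its part. The centre is counted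
-- when both midpoints are ON, which gives the squares of stage `n`. The original vertex is counted
-- when at stage `f` it was an OFF corner between ON corners, since its two ON neighbours then keep
-- it OFF at stage `c`.
corner-rec : ∀ {n c f} → Halves n c f → total corner n ≡ total square n + total corner f
corner-rec {n} {c} {f} h = begin
  total corner n
    ≡⟨ total-blocks (λ x y → blocks (square n) x y + corner f x y) corner-supported h pointwise ⟩
  Σ₂ (suc f) (λ x y → blocks (square n) x y + corner f x y)
    ≡⟨ Σ₂-+ (suc f) (blocks (square n)) (corner f) ⟩
  Σ₂ (suc f) (blocks (square n)) + Σ₂ (suc f) (corner f)
    ≡⟨ cong₂ _+_ (sym (total-dbl square-supported h)) (total-wide _ corner-supported (ℕ.n≤1+n f)) ⟩
  total square n + total corner f ∎
  where
  open ≡-Reasoning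

  blocked-vertex : ∀ x y {e w n s} → U f (x +ℤ + 1) y ≡ e → U f (x -ℤ + 1) y ≡ w →
                   U f x (y +ℤ + 1) ≡ n → U f x (y -ℤ + 1) ≡ s →
                   (U c x y ∧ not (U f x y)) ∧ many e w n s ≡ false
  blocked-vertex x y refl refl refl refl = blocked-halves h x y

  at-a : ∀ a' a b c w s → (a ∨ a') ≡ a' → (a' ∧ not a) ∧ many b w c s ≡ false →
         corners a' (a ∨ b) (a ∨ c) false ≡ diagonal a' (a ∨ b) (a ∨ c) false + b2n (not a ∧ (b ∧ c))
  at-a = from-yes (∀-Bool? λ a' → ∀-Bool? λ a → ∀-Bool? λ b → ∀-Bool? λ c → ∀-Bool? λ w → ∀-Bool? λ s →
    (a ∨ a') 𝔹.≟ a' →-dec ((a' ∧ not a) ∧ many b w c s) 𝔹.≟ false →-dec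
    corners a' (a ∨ b) (a ∨ c) false ℕ.≟ diagonal a' (a ∨ b) (a ∨ c) false + b2n (not a ∧ (b ∧ c)))

  at-b : ∀ b' a b d e s → (b ∨ b') ≡ b' → (b' ∧ not b) ∧ many e a d s ≡ false →
         corners (a ∨ b) b' false (b ∨ d) ≡ diagonal (a ∨ b) b' false (b ∨ d) + b2n (not b ∧ (a ∧ d))
  at-b = from-yes (∀-Bool? λ b' → ∀-Bool? λ a → ∀-Bool? λ b → ∀-Bool? λ d → ∀-Bool? λ e → ∀-Bool? λ s →
    (b ∨ b') 𝔹.≟ b' →-dec ((b' ∧ not b) ∧ many e a d s) 𝔹.≟ false →-dec
    corners (a ∨ b) b' false (b ∨ d) ℕ.≟ diagonal (a ∨ b) b' false (b ∨ d) + b2n (not b ∧ (a ∧ d)))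

  at-c : ∀ c' a c d w n → (c ∨ c') ≡ c' → (c' ∧ not c) ∧ many d w n a ≡ false →
         corners (a ∨ c) false c' (c ∨ d) ≡ diagonal (a ∨ c) false c' (c ∨ d) + b2n (not c ∧ (a ∧ d))
  at-c = from-yes (∀-Bool? λ c' → ∀-Bool? λ a → ∀-Bool? λ c → ∀-Bool? λ d → ∀-Bool? λ w → ∀-Bool? λ n →
    (c ∨ c') 𝔹.≟ c' →-dec ((c' ∧ not c) ∧ many d w n a) 𝔹.≟ false →-dec
    corners (a ∨ c) false c' (c ∨ d) ℕ.≟ diagonal (a ∨ c) false c' (c ∨ d) + b2n (not c ∧ (a ∧ d)))

  at-d : ∀ d' b c d e n → (d ∨ d') ≡ d' → (d' ∧ not d) ∧ many e c n b ≡ false →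
         corners false (b ∨ d) (c ∨ d) d' ≡ diagonal false (b ∨ d) (c ∨ d) d' + b2n (not d ∧ (b ∧ c))
  at-d = from-yes (∀-Bool? λ d' → ∀-Bool? λ b → ∀-Bool? λ c → ∀-Bool? λ d → ∀-Bool? λ e → ∀-Bool? λ n →
    (d ∨ d') 𝔹.≟ d' →-dec ((d' ∧ not d) ∧ many e c n b) 𝔹.≟ false →-dec
    corners false (b ∨ d) (c ∨ d) d' ℕ.≟ diagonal false (b ∨ d) (c ∨ d) d' + b2n (not d ∧ (b ∧ c)))

  shuffle : ∀ p q r s a b c d →
    ((p + a) + (q + c)) + ((r + b) + (s + d)) ≡ ((p + q) + (r + s)) + ((a + d) + (b + c))
  shuffle = ℕRing.solve-∀

  pointwise : ∀ x y → blocks (corner n) x y ≡ blocks (square n) x y + corner f x y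
  pointwise x y = begin
    blocks (corner n) x y
      ≡⟨ onSquare-blocks corners h x y ⟩
    squareBlocks corners a' b' c' d' a b c₀ d
      ≡⟨ cong₂ _+_
           (cong₂ _+_
             (at-a a' a b c₀ (U f (x -ℤ + 1) y) (U f x (y -ℤ + 1)) (mono-halves h x y) (blocked-vertex x y refl refl refl refl))
             (at-c c' a c₀ d (U f (x -ℤ + 1) y⁺) (U f x (y⁺ +ℤ + 1)) (mono-halves h x y⁺)
               (blocked-vertex x y⁺ refl refl refl (cong (U f x) (x+1-1 y)))))
           (cong₂ _+_
             (at-b b' a b d (U f (x⁺ +ℤ + 1) y) (U f x⁺ (y -ℤ + 1)) (mono-halves h x⁺ y)
               (blocked-vertex x⁺ y refl (cong (λ z → U f z y) (x+1-1 x)) refl refl))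
             (at-d d' b c₀ d (U f (x⁺ +ℤ + 1) y⁺) (U f x⁺ (y⁺ +ℤ + 1)) (mono-halves h x⁺ y⁺)
               (blocked-vertex x⁺ y⁺ refl (cong (λ z → U f z y⁺) (x+1-1 x)) refl
                 (cong (U f x⁺) (x+1-1 y))))) ⟩
    ((diagonal a' (a ∨ b) (a ∨ c₀) false + b2n (not a ∧ (b ∧ c₀)))
      + (diagonal (a ∨ c₀) false c' (c₀ ∨ d) + b2n (not c₀ ∧ (a ∧ d))))
    + ((diagonal (a ∨ b) b' false (b ∨ d) + b2n (not b ∧ (a ∧ d)))
      + (diagonal false (b ∨ d) (c₀ ∨ d) d' + b2n (not d ∧ (b ∧ c₀))))
      ≡⟨ shuffle (diagonal a' (a ∨ b) (a ∨ c₀) false) (diagonal (a ∨ c₀) false c' (c₀ ∨ d))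
           (diagonal (a ∨ b) b' false (b ∨ d)) (diagonal false (b ∨ d) (c₀ ∨ d) d')
           (b2n (not a ∧ (b ∧ c₀))) (b2n (not b ∧ (a ∧ d)))
           (b2n (not c₀ ∧ (a ∧ d))) (b2n (not d ∧ (b ∧ c₀))) ⟩
    squareBlocks diagonal a' b' c' d' a b c₀ d + corner f x y
      ≡⟨ cong (_+ corner f x y) (onSquare-blocks diagonal h x y) ⟨
    blocks (square n) x y + corner f x y ∎
    where
    x⁺ = x +ℤ + 1
    y⁺ = y +ℤ + 1
    a  = U f x y
    b  = U f x⁺ y
    c₀ = U f x y⁺
    d  = U f x⁺ y⁺
    a' = U c x y
    b' = U c x⁺ y
    c' = U c x y⁺
    d' = U c x⁺ y⁺

-- The ON midpoints are the edges with an ON end. Adding the edges with two ON ends turns this into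
-- a count of ON ends, four for each ON cell.
cell-rec : ∀ {n c f} → Halves n c f → total cell n + total pair f ≡ total cell c + 4 * total cell f
cell-rec {n} {c} {f} h = begin
  total cell n + total pair f
    ≡⟨ cong₂ _+_ (total-dbl cell-supported h) (sym (total-wide R pair-supported f≤R)) ⟩
  Σ₂ R (blocks (cell n)) + Σ₂ R (pair f)
    ≡⟨ Σ₂-+ R (blocks (cell n)) (pair f) ⟨
  Σ₂ R (λ x y → blocks (cell n) x y + pair f x y)
    ≡⟨ Σ₂-cong R pointwise ⟩
  Σ₂ R (λ x y → cell c x y + ends x y)
    ≡⟨ Σ₂-+ R (cell c) ends ⟩
  Σ₂ R (cell c) + Σ₂ R ends
    ≡⟨ cong₂ _+_ (total-wide R cell-supported (ceil≤1+floor h)) end-count ⟩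
  total cell c + 4 * total cell f ∎
  where
  open ≡-Reasoning
  open HalvesAt (halvesAt h)
  R = suc f
  f≤R = ℕ.n≤1+n f
  cell→ cell↑ ends : ℤ → ℤ → ℕ
  cell→ x y = cell f (x +ℤ + 1) y
  cell↑ x y = cell f x (y +ℤ + 1)
  ends x y = (cell f x y + cell f x y) + (cell→ x y + cell↑ x y)

  pointwise : ∀ x y → blocks (cell n) x y + pair f x y ≡ cell c x y + ends x y
  pointwise x y rewrite evev x y | odev x y | evod x y | odod x y =
    from-yes (∀-Bool? λ c → ∀-Bool? λ a → ∀-Bool? λ e → ∀-Bool? λ n →
        ((b2n c + b2n (a ∨ n)) + (b2n (a ∨ e) + 0)) + (b2n (a ∧ e) + b2n (a ∧ n)) ℕ.≟
        b2n c + ((b2n a + b2n a) + (b2n e + b2n n)))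
      (U c x y) (U f x y) (U f (x +ℤ + 1) y) (U f x (y +ℤ + 1))

  here : Σ₂ R (cell f) ≡ total cell f
  here = total-wide R cell-supported f≤R

  four : ∀ n → (n + n) + (n + n) ≡ 4 * n
  four = ℕRing.solve-∀

  end-count : Σ₂ R ends ≡ 4 * total cell f
  end-count = begin
    Σ₂ R ends
      ≡⟨ trans (Σ₂-+ R _ _) (cong₂ _+_ (Σ₂-+ R _ _) (Σ₂-+ R _ _)) ⟩
    (Σ₂ R (cell f) + Σ₂ R (cell f)) + (Σ₂ R cell→ + Σ₂ R cell↑)
      ≡⟨ cong₂ _+_ (cong₂ _+_ here here)
           (cong₂ _+_ (trans (Σ₂-shift-x (cell-supported f) f≤R) here)
                      (trans (Σ₂-shift-y (cell-supported f) f≤R) here)) ⟩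
    (total cell f + total cell f) + (total cell f + total cell f)
      ≡⟨ four (total cell f) ⟩
    4 * total cell f ∎

-- The tree of ON cells

New : ℕ → ℤ → ℤ → Bool
New k x y = U (suc k) x y ∧ not (U k x y)

-- A new cell has exactly one ON neighbour and no new neighbour, so it adds exactly one pair.
pair-step : ∀ k → total pair (suc (suc k)) + total cell (suc k) ≡
                  total pair (suc k) + total cell (suc (suc k))
pair-step k' = begin
  total pair (suc k) + total cell k
    ≡⟨ cong (_+_ (total pair (suc k))) (total-wide R cell-supported k≤R) ⟨
  Σ₂ R (pair (suc k)) + Σ₂ R (cell k)
    -- A new edge has exactly one new end and is charged to it by the direction of the old end; the
    -- shifts that follow move each charge to the new cell itself.
    ≡⟨ cong (_+ Σ₂ R (cell k)) (Σ₂-cong R new-pairs) ⟩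
  Σ₂ R (λ x y → pair k x y + ((E x y + W (x +ℤ + 1) y) + (N x y + S x (y +ℤ + 1)))) + Σ₂ R (cell k)
    ≡⟨ cong (_+ Σ₂ R (cell k)) (trans (Σ₂-+ R _ _) (cong (_+_ (Σ₂ R (pair k)))
         (trans (Σ₂-+ R _ _) (cong₂ _+_
           (trans (Σ₂-+ R _ _) (cong (_+_ (Σ₂ R E)) (Σ₂-shift-x W-supported ℕ.≤-refl)))
           (trans (Σ₂-+ R _ _) (cong (_+_ (Σ₂ R N)) (Σ₂-shift-y S-supported ℕ.≤-refl))))))) ⟩
  (Σ₂ R (pair k) + ((Σ₂ R E + Σ₂ R W) + (Σ₂ R N + Σ₂ R S))) + Σ₂ R (cell k)
    ≡⟨ ℕ.+-assoc (Σ₂ R (pair k)) _ _ ⟩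
  Σ₂ R (pair k) + (((Σ₂ R E + Σ₂ R W) + (Σ₂ R N + Σ₂ R S)) + Σ₂ R (cell k))
    ≡⟨ cong (_+_ (Σ₂ R (pair k))) (trans (cong (_+ Σ₂ R (cell k))
         (sym (trans (Σ₂-+ R _ _) (cong₂ _+_ (Σ₂-+ R _ _) (Σ₂-+ R _ _))))) (sym (Σ₂-+ R _ _))) ⟩
  Σ₂ R (pair k) + Σ₂ R (λ x y → ((E x y + W x y) + (N x y + S x y)) + cell k x y)
    ≡⟨ cong₂ _+_ (total-wide R pair-supported k≤R) (Σ₂-cong R one-neighbour) ⟩
  total pair k + total cell (suc k) ∎
  where
  open ≡-Reasoning
  k = suc k'
  R = suc k
  k≤R = ℕ.n≤1+n k
  E W N S : ℤ → ℤ → ℕ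
  E x y = b2n (New k x y ∧ U k (x +ℤ + 1) y)
  W x y = b2n (New k x y ∧ U k (x -ℤ + 1) y)
  N x y = b2n (New k x y ∧ U k x (y +ℤ + 1))
  S x y = b2n (New k x y ∧ U k x (y -ℤ + 1))

  W-supported : Supported R W
  W-supported x y o rewrite U-outside R x y o = refl

  S-supported : Supported R S
  S-supported x y o rewrite U-outside R x y o = refl

  one-neighbour : ∀ x y → ((E x y + W x y) + (N x y + S x y)) + cell k x y ≡ cell (suc k) x y
  one-neighbour x y = from-yes
    (∀-Bool? λ c → ∀-Bool? λ e → ∀-Bool? λ w → ∀-Bool? λ n → ∀-Bool? λ s →
      let new = (c ∨ one4 e w n s) ∧ not c in
      ((b2n (new ∧ e) + b2n (new ∧ w)) + (b2n (new ∧ n) + b2n (new ∧ s))) + b2n c ℕ.≟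
      b2n (c ∨ one4 e w n s))
    (U k x y) (U k (x +ℤ + 1) y) (U k (x -ℤ + 1) y) (U k x (y +ℤ + 1)) (U k x (y -ℤ + 1))

  edge : ∀ a b a' b' → (a ∨ a') ≡ a' → (b ∨ b') ≡ b' → (a' ∧ b') ∧ not (a ∨ b) ≡ false →
         b2n (a' ∧ b') ≡ b2n (a ∧ b) + (b2n ((a' ∧ not a) ∧ b) + b2n ((b' ∧ not b) ∧ a))
  edge = from-yes (∀-Bool? λ a → ∀-Bool? λ b → ∀-Bool? λ a' → ∀-Bool? λ b' →
    (a ∨ a') 𝔹.≟ a' →-dec (b ∨ b') 𝔹.≟ b' →-dec ((a' ∧ b') ∧ not (a ∨ b)) 𝔹.≟ false →-dec
    b2n (a' ∧ b') ℕ.≟ b2n (a ∧ b) + (b2n ((a' ∧ not a) ∧ b) + b2n ((b' ∧ not b) ∧ a)))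

  shuffle : ∀ a b c d → (a + b) + (c + d) ≡ (a + c) + (b + d)
  shuffle = ℕRing.solve-∀

  new-pairs : ∀ x y → pair (suc k) x y ≡
              pair k x y + ((E x y + W (x +ℤ + 1) y) + (N x y + S x (y +ℤ + 1)))
  new-pairs x y = trans
    (cong₂ _+_
      (trans (edge (U k x y) (U k (x +ℤ + 1) y) (U R x y) (U R (x +ℤ + 1) y)
               (U-mono k x y) (U-mono k (x +ℤ + 1) y) (proj₁ (U-independent k) x y))
             (cong (λ z → b2n (U k x y ∧ U k (x +ℤ + 1) y) + (E x y + b2n (New k (x +ℤ + 1) y ∧ U k z y)))
               (sym (x+1-1 x))))
      (trans (edge (U k x y) (U k x (y +ℤ + 1)) (U R x y) (U R x (y +ℤ + 1))
               (U-mono k x y) (U-mono k x (y +ℤ + 1)) (proj₂ (U-independent k) x y))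
             (cong (λ z → b2n (U k x y ∧ U k x (y +ℤ + 1)) + (N x y + b2n (New k x (y +ℤ + 1) ∧ U k x z)))
               (sym (x+1-1 y)))))
    (shuffle (b2n (U k x y ∧ U k (x +ℤ + 1) y)) _ (b2n (U k x y ∧ U k x (y +ℤ + 1))) _)

-- A tree has one edge fewer than vertices: this holds for the single cell of stage 1, and by
-- `pair-step` each later stage adds as many edges as cells.
pair-count : ∀ k → suc (total pair (suc k)) ≡ total cell (suc k)
pair-count zero    = refl
pair-count (suc k) = ℕ.+-cancelˡ-≡ (total cell (suc k)) _ _ (begin
  total cell (suc k) + suc (total pair (2 + k))
    ≡⟨ trans (ℕ.+-suc _ _) (cong suc (ℕ.+-comm (total cell (suc k)) _)) ⟩
  suc (total pair (2 + k) + total cell (suc k))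
    ≡⟨ cong suc (pair-step k) ⟩
  suc (total pair (suc k)) + total cell (2 + k)
    ≡⟨ cong (_+ total cell (2 + k)) (pair-count k) ⟩
  total cell (suc k) + total cell (2 + k) ∎)
  where open ≡-Reasoning

-- Rule 942 as U with its holes filled

-- The cell itself was OFF at stage `k`, so none of its neighbours had four ON neighbours then.
holes-off : ∀ k x y → U (suc k) x y ≡ false →
  (Hole k (x +ℤ + 1) y ≡ false × Hole k (x -ℤ + 1) y ≡ false) ×
  (Hole k x (y +ℤ + 1) ≡ false × Hole k x (y -ℤ + 1) ≡ false)
holes-off k x y p
  rewrite x+1-1 x | x-1+1 x | x+1-1 y | x-1+1 y | 𝔹.∨-conicalˡ (U k x y) (U (suc k) x y) (trans (U-mono k x y) p)
  = (west (U k (x +ℤ + 1) y) (U k (x +ℤ + 1 +ℤ + 1) y) , 𝔹.∧-zeroʳ _)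
  , (south (U k x (y +ℤ + 1)) (U k (x +ℤ + 1) (y +ℤ + 1) ∧ U k (x -ℤ + 1) (y +ℤ + 1)) (U k x (y +ℤ + 1 +ℤ + 1))
    , north (U k x (y -ℤ + 1)) (U k (x +ℤ + 1) (y -ℤ + 1) ∧ U k (x -ℤ + 1) (y -ℤ + 1)))
  where
  west : ∀ c e {v} → not c ∧ ((e ∧ false) ∧ v) ≡ false
  west c e rewrite 𝔹.∧-zeroʳ e = 𝔹.∧-zeroʳ _
  south : ∀ c h n → not c ∧ (h ∧ (n ∧ false)) ≡ false
  south c h n rewrite 𝔹.∧-zeroʳ n | 𝔹.∧-zeroʳ h = 𝔹.∧-zeroʳ _
  north : ∀ c h → not c ∧ (h ∧ false) ≡ false
  north c h rewrite 𝔹.∧-zeroʳ h = 𝔹.∧-zeroʳ _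

-- The four ON neighbours stay ON, so a filled hole is accounted for by the holes of the next stage.
Hole-closed : ∀ k x y → Hole k x y ∧ not (nbrs all4 (suc k) x y) ≡ false
Hole-closed k x y = closed (U k x y) (U k (x +ℤ + 1) y) (U k (x -ℤ + 1) y) (U k x (y +ℤ + 1)) (U k x (y -ℤ + 1))
  (U-mono k (x +ℤ + 1) y) (U-mono k (x -ℤ + 1) y) (U-mono k x (y +ℤ + 1)) (U-mono k x (y -ℤ + 1))
  where
  closed : ∀ c e w n s {e' w' n' s'} → e ∨ e' ≡ e' → w ∨ w' ≡ w' → n ∨ n' ≡ n' → s ∨ s' ≡ s' →
           (not c ∧ all4 e w n s) ∧ not (all4 e' w' n' s') ≡ false
  closed c true  true  true  true refl refl refl refl = 𝔹.∧-zeroʳ _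
  closed c true  true  true  false _ _ _ _ rewrite 𝔹.∧-zeroʳ (not c) = refl
  closed c true  true  false s     _ _ _ _ rewrite 𝔹.∧-zeroʳ (not c) = refl
  closed c true  false n     s     _ _ _ _ rewrite 𝔹.∧-zeroʳ (not c) = refl
  closed c false w     n     s     _ _ _ _ rewrite 𝔹.∧-zeroʳ (not c) = refl

Hole-fresh : ∀ k x y → Hole k x y ∧ U (suc k) x y ≡ false
Hole-fresh k x y = from-yes
  (∀-Bool? λ c' → ∀-Bool? λ c → ∀-Bool? λ e → ∀-Bool? λ w → ∀-Bool? λ n → ∀-Bool? λ s →
    ((c' ∧ not c) ∧ many e w n s) 𝔹.≟ false →-dec ((not c ∧ all4 e w n s) ∧ c') 𝔹.≟ false)
  (U (suc k) x y) (U k x y) (U k (x +ℤ + 1) y) (U k (x -ℤ + 1) y) (U k x (y +ℤ + 1)) (U k x (y -ℤ + 1))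
  (blocked k x y)

four942 : Bool → Bool → Bool → Bool → Bool
four942 e w n s = rule942 (b2n e + b2n w + b2n n + b2n s)

-- One stage of Rule 942 at a single cell. A cell ON in U stays ON. Around a cell OFF in U no
-- neighbour is a filled hole, so the rule sees the neighbours in U: one ON is the step of U, four
-- ON is a hole.
fill : ∀ c hc e w n s {he hw hn hs} →
       (c ≡ false → (he ≡ false × hw ≡ false) × (hn ≡ false × hs ≡ false)) →
       hc ∧ not (all4 e w n s) ≡ false →
       (c ∨ hc) ∨ four942 (e ∨ he) (w ∨ hw) (n ∨ hn) (s ∨ hs) ≡
       (c ∨ one4 e w n s) ∨ (not c ∧ all4 e w n s)
fill true  hc e w n s _ _ = refl
fill false hc e w n s off q with off refl
... | (refl , refl) , (refl , refl)
  rewrite 𝔹.∨-identityʳ e | 𝔹.∨-identityʳ w | 𝔹.∨-identityʳ n | 𝔹.∨-identityʳ s = from-yes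
  (∀-Bool? λ hc → ∀-Bool? λ e → ∀-Bool? λ w → ∀-Bool? λ n → ∀-Bool? λ s →
    (hc ∧ not (all4 e w n s)) 𝔹.≟ false →-dec
    (hc ∨ four942 e w n s) 𝔹.≟ (one4 e w n s ∨ all4 e w n s))
  hc e w n s q

-- Filling a hole has no further effect, since all four neighbours of a hole are ON already.
on-Hole : ∀ k x y → on rule942 (suc k) x y ≡ U (suc k) x y ∨ Hole k x y
on-Hole zero    x y = sym (𝔹.∨-identityʳ _)
on-Hole (suc k) x y = trans
  (cong₂ _∨_ (on-Hole k x y) (cong rule942 (cong₂ _+_ (cong₂ _+_ (cong₂ _+_
    (cong b2n (on-Hole k (x +ℤ + 1) y)) (cong b2n (on-Hole k (x -ℤ + 1) y)))
    (cong b2n (on-Hole k x (y +ℤ + 1)))) (cong b2n (on-Hole k x (y -ℤ + 1))))))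
  (fill (U (suc k) x y) (Hole k x y) (U (suc k) (x +ℤ + 1) y) (U (suc k) (x -ℤ + 1) y)
    (U (suc k) x (y +ℤ + 1)) (U (suc k) x (y -ℤ + 1)) (holes-off k x y) (Hole-closed k x y))

-- Counting the newly ON cells

onCell : (ℕ → Bool) → ℕ → ℤ → ℤ → ℕ
onCell rule k x y = b2n (on rule k x y)

newCount-step : ∀ rule k → (∀ x y → Outside (2 + k) x y → on rule (2 + k) x y ≡ false) →
                newCount rule (2 + k) + Σ₂ (2 + k) (onCell rule (suc k)) ≡ total (onCell rule) (2 + k)
newCount-step rule k out = begin
  newCount rule (2 + k) + Σ₂ (2 + k) (onCell rule (suc k))
    ≡⟨ cong (_+ Σ₂ (2 + k) (onCell rule (suc k))) (newCount≡Σ₂ rule (2 + k)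
         (λ x y o → cong (λ b → b2n (b ∧ not (on rule (suc k) x y))) (out x y o))) ⟩
  Σ₂ (2 + k) (λ x y → b2n (turnedOn rule (2 + k) x y)) + Σ₂ (2 + k) (onCell rule (suc k))
    ≡⟨ Σ₂-+ (2 + k) _ _ ⟨
  Σ₂ (2 + k) (λ x y → b2n (turnedOn rule (2 + k) x y) + onCell rule (suc k) x y)
    ≡⟨ Σ₂-cong (2 + k) (λ x y → split (on rule (suc k) x y) (rule (onNbrs (on rule (suc k)) x y))) ⟩
  total (onCell rule) (2 + k) ∎
  where
  open ≡-Reasoning
  split : ∀ c o → b2n ((c ∨ o) ∧ not c) + b2n c ≡ b2n (c ∨ o)
  split = from-yes (∀-Bool? λ c → ∀-Bool? λ o → b2n ((c ∨ o) ∧ not c) + b2n c ℕ.≟ b2n (c ∨ o))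

on942-count : ∀ R k → suc k ≤ R → Σ₂ R (onCell rule942 (suc k)) ≡ total cell (suc k) + total hole k
on942-count R k k<R = begin
  Σ₂ R (onCell rule942 (suc k))
    ≡⟨ Σ₂-cong R (λ x y → trans (cong b2n (on-Hole k x y))
         (disjoint (Hole k x y) (U (suc k) x y) (Hole-fresh k x y))) ⟩
  Σ₂ R (λ x y → cell (suc k) x y + hole k x y)
    ≡⟨ Σ₂-+ R _ _ ⟩
  Σ₂ R (cell (suc k)) + Σ₂ R (hole k)
    ≡⟨ cong₂ _+_ (total-wide R cell-supported k<R) (total-wide R hole-supported (ℕ.<⇒≤ k<R)) ⟩
  total cell (suc k) + total hole k ∎
  where
  open ≡-Reasoning
  disjoint : ∀ h c → h ∧ c ≡ false → b2n (c ∨ h) ≡ b2n c + b2n h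
  disjoint = from-yes (∀-Bool? λ h → ∀-Bool? λ c → (h ∧ c) 𝔹.≟ false →-dec b2n (c ∨ h) ℕ.≟ b2n c + b2n h)

-- Rule 942 has the cells of U and the holes one stage older, so `w` and `u` differ by the increment
-- of the holes from stage `k` to `suc k`.
w+hole : ∀ k → w (2 + k) + total hole k ≡ u (2 + k) + total hole (suc k)
w+hole k = ℕ.+-cancelˡ-≡ (total cell (suc k)) _ _ (begin
  N + (w (2 + k) + total hole k)
    ≡⟨ shuffle₁ N (w (2 + k)) _ ⟩
  w (2 + k) + (N + total hole k)
    ≡⟨ cong (_+_ (w (2 + k))) (on942-count (2 + k) k (ℕ.n≤1+n _)) ⟨
  w (2 + k) + Σ₂ (2 + k) (onCell rule942 (suc k))
    ≡⟨ newCount-step rule942 k out ⟩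
  total (onCell rule942) (2 + k)
    ≡⟨ on942-count (2 + k) (suc k) ℕ.≤-refl ⟩
  total cell (2 + k) + total hole (suc k)
    ≡⟨ cong (_+ total hole (suc k)) (newCount-step ruleUW k (U-outside (2 + k))) ⟨
  (u (2 + k) + Σ₂ (2 + k) (cell (suc k))) + total hole (suc k)
    ≡⟨ cong (λ z → (u (2 + k) + z) + total hole (suc k)) (total-wide (2 + k) cell-supported (ℕ.n≤1+n _)) ⟩
  (u (2 + k) + N) + total hole (suc k)
    ≡⟨ shuffle₂ (u (2 + k)) N _ ⟩
  N + (u (2 + k) + total hole (suc k)) ∎)
  where
  open ≡-Reasoning
  N = total cell (suc k)
  shuffle₁ : ∀ a b c → a + (b + c) ≡ b + (a + c)
  shuffle₁ = ℕRing.solve-∀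
  shuffle₂ : ∀ a b c → (a + b) + c ≡ b + (a + c)
  shuffle₂ = ℕRing.solve-∀
  out : ∀ x y → Outside (2 + k) x y → on rule942 (2 + k) x y ≡ false
  out x y o rewrite on-Hole (suc k) x y | U-outside (2 + k) x y o = Hole-outside (suc k) x y (narrow o)
    where
    narrow : Outside (2 + k) x y → Outside (suc k) x y
    narrow (inj₁ p) = inj₁ (ℕ.<⇒≤ p)
    narrow (inj₂ p) = inj₂ (ℕ.<⇒≤ p)

-- Increments of the counts

abstract
  -- Kept abstract so that only the recurrences below are visible and no comparison of counts
  -- evaluates the automata.
  cellCount holeCount squareCount cornerCount : ℕ → ℕ
  cellCount     = total cell
  holeCount     = total hole
  squareCount   = total square
  cornerCount = total corner

  cells-zero : cellCount 0 ≡ 0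
  cells-zero = refl

  cells-one : cellCount 1 ≡ 1
  cells-one = refl

  -- The tree property replaces the edges at the floor stage by its cells minus one. The floor is at
  -- least 1, because stage 0 has no cell at all.
  cells-rec : ∀ {n c f} → Halves n c (suc f) → cellCount n ≡ suc (cellCount c + 3 * cellCount (suc f))
  cells-rec {n} {c} {f} h = ℕ.+-cancelʳ-≡ (total pair (suc f)) _ _ (begin
    cellCount n + total pair (suc f)
      ≡⟨ cell-rec h ⟩
    cellCount c + 4 * cellCount (suc f)
      ≡⟨ four (cellCount c) (cellCount (suc f)) ⟩
    (cellCount c + 3 * cellCount (suc f)) + cellCount (suc f)
      ≡⟨ cong (_+_ (cellCount c + 3 * cellCount (suc f))) (pair-count f) ⟨
    (cellCount c + 3 * cellCount (suc f)) + suc (total pair (suc f))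
      ≡⟨ ℕ.+-suc _ _ ⟩
    suc (cellCount c + 3 * cellCount (suc f)) + total pair (suc f) ∎)
    where
    open ≡-Reasoning
    four : ∀ a b → a + 4 * b ≡ (a + 3 * b) + b
    four = ℕRing.solve-∀

  holes-rec : ∀ {n c f} → Halves n c f → holeCount n ≡ holeCount f + squareCount f
  holes-rec = hole-rec

  squares-rec : ∀ {n c f} → Halves n c f → squareCount n ≡ 4 * cellCount f + cornerCount f
  squares-rec = square-rec

  corners-rec : ∀ {n c f} → Halves n c f → cornerCount n ≡ squareCount n + cornerCount f
  corners-rec = corner-rec

  w+holes : ∀ k → w (2 + k) + holeCount k ≡ u (2 + k) + holeCount (suc k)
  w+holes = w+hole

Δ : (ℕ → ℕ) → ℕ → ℤ
Δ F s = + F (suc s) -ℤ + F s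

Δ-const : ∀ F s → F (suc s) ≡ F s → Δ F s ≡ + 0
Δ-const F s e = trans (cong (λ z → + z -ℤ + F s) e) (ℤ.i≡j⇒i-j≡0 {+ F s} refl)

Δ-+ : ∀ a b c d → (+ (a + b)) -ℤ (+ (c + d)) ≡ (+ a -ℤ + c) +ℤ (+ b -ℤ + d)
Δ-+ a b c d = lemma (+ a) (+ b) (+ c) (+ d)
  where
  lemma : ∀ a b c d → (a +ℤ b) -ℤ (c +ℤ d) ≡ (a -ℤ c) +ℤ (b -ℤ d)
  lemma = solve-∀

Δ-* : ∀ k a b → (+ (k * a)) -ℤ (+ (k * b)) ≡ + k *ℤ (+ a -ℤ + b)
Δ-* k a b rewrite ℤ.pos-* k a | ℤ.pos-* k b = lemma (+ k) (+ a) (+ b)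
  where
  lemma : ∀ k a b → k *ℤ a -ℤ k *ℤ b ≡ k *ℤ (a -ℤ b)
  lemma = solve-∀

-- Stages 2m and 2m + 1 share the floor m, and the holes depend on the floor only; so do the squares
-- and the corners.
Δholes-even : ∀ m → Δ holeCount (dbl m) ≡ + 0
Δholes-even m = Δ-const holeCount (dbl m) (trans (holes-rec (odd m)) (sym (holes-rec (even m))))

Δholes-odd : ∀ m → Δ holeCount (suc (dbl m)) ≡ Δ holeCount m +ℤ Δ squareCount m
Δholes-odd m = trans (cong₂ (λ a b → + a -ℤ + b) (holes-rec (even (suc m))) (holes-rec (odd m)))
                     (Δ-+ (holeCount (suc m)) (squareCount (suc m)) (holeCount m) (squareCount m))

Δsquares-even : ∀ m → Δ squareCount (dbl m) ≡ + 0
Δsquares-even m = Δ-const squareCount (dbl m) (trans (squares-rec (odd m)) (sym (squares-rec (even m))))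

Δsquares-odd : ∀ m → Δ squareCount (suc (dbl m)) ≡ + 4 *ℤ Δ cellCount m +ℤ Δ cornerCount m
Δsquares-odd m = trans (cong₂ (λ a b → + a -ℤ + b) (squares-rec (even (suc m))) (squares-rec (odd m)))
  (trans (Δ-+ (4 * cellCount (suc m)) (cornerCount (suc m)) (4 * cellCount m) (cornerCount m)) (cong (_+ℤ Δ cornerCount m) (Δ-* 4 (cellCount (suc m)) (cellCount m))))

Δcorners-even : ∀ m → Δ cornerCount (dbl m) ≡ + 0
Δcorners-even m = Δ-const cornerCount (dbl m)
  (trans (corners-rec (odd m)) (trans
    (cong (_+ cornerCount m) (trans (squares-rec (odd m)) (sym (squares-rec (even m)))))
    (sym (corners-rec (even m)))))

Δcorners-odd : ∀ m → Δ cornerCount (suc (dbl m)) ≡ Δ squareCount (suc (dbl m)) +ℤ Δ cornerCount m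
Δcorners-odd m = trans (cong₂ (λ a b → + a -ℤ + b) (corners-rec (even (suc m))) (corners-rec (odd m)))
                       (Δ-+ (squareCount (dbl (suc m))) (cornerCount (suc m)) (squareCount (suc (dbl m))) (cornerCount m))

-- Here the ceiling varies and the floor is fixed. In `Δcells-odd` it is the reverse, and the
-- coefficient 3 of the floor appears.
Δcells-even : ∀ m → 1 ≤ m → Δ cellCount (dbl m) ≡ Δ cellCount m
Δcells-even (suc m) _ = begin
  Δ cellCount (dbl (suc m))
    ≡⟨ cong₂ (λ a b → + a -ℤ + b) (cells-rec (odd (suc m))) (cells-rec (even (suc m))) ⟩
  + suc (cellCount (2 + m) + 3 * cellCount (suc m)) -ℤ + suc (cellCount (suc m) + 3 * cellCount (suc m))
    ≡⟨ lemma (+ cellCount (2 + m)) (+ cellCount (suc m)) (+ (3 * cellCount (suc m))) ⟩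
  Δ cellCount (suc m) ∎
  where
  open ≡-Reasoning
  lemma : ∀ a b c → (+ 1 +ℤ (a +ℤ c)) -ℤ (+ 1 +ℤ (b +ℤ c)) ≡ a -ℤ b
  lemma = solve-∀

Δcells-odd : ∀ m → 1 ≤ m → Δ cellCount (suc (dbl m)) ≡ + 3 *ℤ Δ cellCount m
Δcells-odd (suc m) _ = begin
  Δ cellCount (suc (dbl (suc m)))
    ≡⟨ cong₂ (λ a b → + a -ℤ + b) (cells-rec (even (2 + m))) (cells-rec (odd (suc m))) ⟩
  + suc (cellCount (2 + m) + 3 * cellCount (2 + m)) -ℤ + suc (cellCount (2 + m) + 3 * cellCount (suc m))
    ≡⟨ lemma (+ cellCount (2 + m)) (+ (3 * cellCount (2 + m))) (+ (3 * cellCount (suc m))) ⟩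
  + (3 * cellCount (2 + m)) -ℤ + (3 * cellCount (suc m))
    ≡⟨ Δ-* 3 (cellCount (2 + m)) (cellCount (suc m)) ⟩
  + 3 *ℤ Δ cellCount (suc m) ∎
  where
  open ≡-Reasoning
  lemma : ∀ a b c → (+ 1 +ℤ (a +ℤ b)) -ℤ (+ 1 +ℤ (a +ℤ c)) ≡ b -ℤ c
  lemma = solve-∀

Δcells-one : Δ cellCount 1 ≡ + 4
Δcells-one = cong₂ (λ a b → + a -ℤ + b)
  (trans (cells-rec (even 1)) (cong (λ z → suc (z + 3 * z)) cells-one)) cells-one

-- tower i s = 2 ^ i * (s + 1) ∸ 1, so that Δ F (tower i s) is the increment of F into
-- stage 2 ^ i * (s + 1).
tower : ℕ → ℕ → ℕ
tower zero    s = s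
tower (suc i) s = suc (dbl (tower i s))

dbl≡2* : ∀ n → dbl n ≡ 2 * n
dbl≡2* zero    = refl
dbl≡2* (suc n) = cong suc (trans (cong suc (dbl≡2* n)) (sym (ℕ.+-suc n (n + 0))))

suc-tower : ∀ i s → suc (tower i s) ≡ 2 ^ i * suc s
suc-tower zero    s = sym (ℕ.+-identityʳ (suc s))
suc-tower (suc i) s = begin
  dbl (suc (tower i s))   ≡⟨ dbl≡2* (suc (tower i s)) ⟩
  2 * suc (tower i s)     ≡⟨ cong (2 *_) (suc-tower i s) ⟩
  2 * (2 ^ i * suc s)     ≡⟨ ℕ.*-assoc 2 (2 ^ i) (suc s) ⟨
  2 ^ suc i * suc s       ∎
  where open ≡-Reasoning

1≤tower : ∀ i {s} → 1 ≤ s → 1 ≤ tower i s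
1≤tower zero    1≤s = 1≤s
1≤tower (suc i) 1≤s = s≤s z≤n

Δcells-tower : ∀ i s → 1 ≤ s → Δ cellCount (tower i s) ≡ + (3 ^ i) *ℤ Δ cellCount s
Δcells-tower zero    s 1≤s = sym (ℤ.*-identityˡ _)
Δcells-tower (suc i) s 1≤s = begin
  Δ cellCount (tower (suc i) s)              ≡⟨ Δcells-odd (tower i s) (1≤tower i 1≤s) ⟩
  + 3 *ℤ Δ cellCount (tower i s)             ≡⟨ cong (_*ℤ_ (+ 3)) (Δcells-tower i s 1≤s) ⟩
  + 3 *ℤ (+ (3 ^ i) *ℤ Δ cellCount s)        ≡⟨ ℤ.*-assoc (+ 3) (+ (3 ^ i)) (Δ cellCount s) ⟨
  (+ 3 *ℤ + (3 ^ i)) *ℤ Δ cellCount s        ≡⟨ cong (_*ℤ Δ cellCount s) (ℤ.pos-* 3 (3 ^ i)) ⟨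
  + (3 ^ suc i) *ℤ Δ cellCount s             ∎
  where open ≡-Reasoning

-- Stages 2^i q with q = 2p + 1 at least 3; `v` is the increment of the cells into stage q.
module EvenTower (p : ℕ) (1≤p : 1 ≤ p) where
  open ≡-Reasoning
  s = dbl p
  v = Δ cellCount s

  1≤s : 1 ≤ s
  1≤s = ℕ.≤-trans 1≤p (n≤dbl p)

  gap : ℕ → ℤ
  gap i = + (3 ^ i) -ℤ + (2 ^ i)

  gap-suc : ∀ i → gap (suc i) ≡ + 3 *ℤ + (3 ^ i) -ℤ + 2 *ℤ + (2 ^ i)
  gap-suc i = cong₂ _-ℤ_ (ℤ.pos-* 3 (3 ^ i)) (ℤ.pos-* 2 (2 ^ i))

  Δsquares-via : ∀ i → Δ cornerCount (tower i s) ≡ + 4 *ℤ gap i *ℤ v →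
                 Δ squareCount (tower (suc i) s) ≡ + 4 *ℤ (+ (3 ^ i) *ℤ v) +ℤ + 4 *ℤ gap i *ℤ v
  Δsquares-via i e = trans (Δsquares-odd (tower i s))
    (cong₂ (λ a b → + 4 *ℤ a +ℤ b) (Δcells-tower i s 1≤s) e)

  -- With C and S the increments of corners and squares, S(i+1) = 4·3^i v + C(i) and C(i+1) = S(i+1)
  -- + C(i), so C(i+1) = 2 C(i) + 4·3^i v with C(0) = 0.
  Δcorners-tower : ∀ i → Δ cornerCount (tower i s) ≡ + 4 *ℤ gap i *ℤ v
  Δcorners-tower zero    = Δcorners-even p
  Δcorners-tower (suc i) = begin
    Δ cornerCount (tower (suc i) s)
      ≡⟨ Δcorners-odd (tower i s) ⟩
    Δ squareCount (tower (suc i) s) +ℤ Δ cornerCount (tower i s)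
      ≡⟨ cong₂ _+ℤ_ (Δsquares-via i (Δcorners-tower i)) (Δcorners-tower i) ⟩
    (+ 4 *ℤ (+ (3 ^ i) *ℤ v) +ℤ + 4 *ℤ gap i *ℤ v) +ℤ + 4 *ℤ gap i *ℤ v
      ≡⟨ lemma (+ (3 ^ i)) (+ (2 ^ i)) v ⟩
    + 4 *ℤ (+ 3 *ℤ + (3 ^ i) -ℤ + 2 *ℤ + (2 ^ i)) *ℤ v
      ≡⟨ cong (λ z → + 4 *ℤ z *ℤ v) (gap-suc i) ⟨
    + 4 *ℤ gap (suc i) *ℤ v ∎
    where
    lemma : ∀ a b v → (+ 4 *ℤ (a *ℤ v) +ℤ + 4 *ℤ (a -ℤ b) *ℤ v) +ℤ + 4 *ℤ (a -ℤ b) *ℤ v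
                      ≡ + 4 *ℤ (+ 3 *ℤ a -ℤ + 2 *ℤ b) *ℤ v
    lemma = solve-∀

  -- The holes obey the recurrence of the corners one level later, starting from 0 because `s` is
  -- even.
  Δholes-tower : ∀ i → Δ holeCount (tower (suc i) s) ≡ + 4 *ℤ gap i *ℤ v
  Δholes-tower zero    = trans (Δholes-odd s) (cong₂ _+ℤ_ (Δholes-even p) (Δsquares-even p))
  Δholes-tower (suc i) = begin
    Δ holeCount (tower (2 + i) s)
      ≡⟨ Δholes-odd (tower (suc i) s) ⟩
    Δ holeCount (tower (suc i) s) +ℤ Δ squareCount (tower (suc i) s)
      ≡⟨ cong₂ _+ℤ_ (Δholes-tower i) (Δsquares-via i (Δcorners-tower i)) ⟩
    + 4 *ℤ gap i *ℤ v +ℤ (+ 4 *ℤ (+ (3 ^ i) *ℤ v) +ℤ + 4 *ℤ gap i *ℤ v)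
      ≡⟨ lemma (+ (3 ^ i)) (+ (2 ^ i)) v ⟩
    + 4 *ℤ (+ 3 *ℤ + (3 ^ i) -ℤ + 2 *ℤ + (2 ^ i)) *ℤ v
      ≡⟨ cong (λ z → + 4 *ℤ z *ℤ v) (gap-suc i) ⟨
    + 4 *ℤ gap (suc i) *ℤ v ∎
    where
    lemma : ∀ a b v → + 4 *ℤ (a -ℤ b) *ℤ v +ℤ (+ 4 *ℤ (a *ℤ v) +ℤ + 4 *ℤ (a -ℤ b) *ℤ v)
                      ≡ + 4 *ℤ (+ 3 *ℤ a -ℤ + 2 *ℤ b) *ℤ v
    lemma = solve-∀

-- Stages that are powers of 2. Tripling of the cell increment fails at the bottom, where it is 1
-- into stage 1 and 4 into stage 2, so the levels are counted from stage 2.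
module ZeroTower where
  open ≡-Reasoning

  -- The solution of C(i+1) = 2 C(i) + 16·3^i with C(0) = 4.
  powers : ℕ → ℤ
  powers i = + 16 *ℤ + (3 ^ i) -ℤ + 12 *ℤ + (2 ^ i)

  powers-suc : ∀ i → powers (suc i) ≡ + 16 *ℤ (+ 3 *ℤ + (3 ^ i)) -ℤ + 12 *ℤ (+ 2 *ℤ + (2 ^ i))
  powers-suc i = cong₂ (λ a b → + 16 *ℤ a -ℤ + 12 *ℤ b) (ℤ.pos-* 3 (3 ^ i)) (ℤ.pos-* 2 (2 ^ i))

  Δcells-zero : ∀ i → Δ cellCount (tower (suc i) 0) ≡ + (3 ^ i) *ℤ + 4
  Δcells-zero zero    = Δcells-one
  Δcells-zero (suc i) = begin
    Δ cellCount (tower (2 + i) 0)     ≡⟨ Δcells-odd (tower (suc i) 0) (s≤s z≤n) ⟩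
    + 3 *ℤ Δ cellCount (tower (suc i) 0) ≡⟨ cong (_*ℤ_ (+ 3)) (Δcells-zero i) ⟩
    + 3 *ℤ (+ (3 ^ i) *ℤ + 4)     ≡⟨ ℤ.*-assoc (+ 3) (+ (3 ^ i)) (+ 4) ⟨
    (+ 3 *ℤ + (3 ^ i)) *ℤ + 4     ≡⟨ cong (_*ℤ + 4) (ℤ.pos-* 3 (3 ^ i)) ⟨
    + (3 ^ suc i) *ℤ + 4          ∎

  Δsquares-via : ∀ i → Δ cornerCount (tower (suc i) 0) ≡ powers i →
                 Δ squareCount (tower (2 + i) 0) ≡ + 4 *ℤ (+ (3 ^ i) *ℤ + 4) +ℤ powers i
  Δsquares-via i e = trans (Δsquares-odd (tower (suc i) 0))
    (cong₂ (λ a b → + 4 *ℤ a +ℤ b) (Δcells-zero i) e)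

  Δsquares-one : Δ squareCount 1 ≡ + 4
  Δsquares-one = trans (Δsquares-odd 0)
    (cong₂ (λ a b → + 4 *ℤ a +ℤ b) (cong₂ (λ a b → + a -ℤ + b) cells-one cells-zero) (Δcorners-even 0))

  step : ∀ i {a b} → a ≡ powers i → b ≡ + 4 *ℤ (+ (3 ^ i) *ℤ + 4) +ℤ powers i → a +ℤ b ≡ powers (suc i)
  step i refl refl = trans (lemma (+ (3 ^ i)) (+ (2 ^ i))) (sym (powers-suc i))
    where
    lemma : ∀ a b → (+ 16 *ℤ a -ℤ + 12 *ℤ b) +ℤ (+ 4 *ℤ (a *ℤ + 4) +ℤ (+ 16 *ℤ a -ℤ + 12 *ℤ b))
                    ≡ + 16 *ℤ (+ 3 *ℤ a) -ℤ + 12 *ℤ (+ 2 *ℤ b)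
    lemma = solve-∀

  Δcorners-zero : ∀ i → Δ cornerCount (tower (suc i) 0) ≡ powers i
  Δcorners-zero zero    = trans (Δcorners-odd 0) (cong₂ _+ℤ_ Δsquares-one (Δcorners-even 0))
  Δcorners-zero (suc i) = trans (Δcorners-odd (tower (suc i) 0)) (trans (ℤ.+-comm (Δ squareCount (tower (2 + i) 0)) _)
    (step i (Δcorners-zero i) (Δsquares-via i (Δcorners-zero i))))

  Δholes-zero : ∀ i → Δ holeCount (tower (2 + i) 0) ≡ powers i
  Δholes-zero zero    = trans (Δholes-odd 1) (cong₂ _+ℤ_
    (trans (Δholes-odd 0) (cong₂ _+ℤ_ (Δholes-even 0) (Δsquares-even 0))) Δsquares-one)
  Δholes-zero (suc i) = trans (Δholes-odd (tower (2 + i) 0))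
    (step i (Δholes-zero i) (Δsquares-via i (Δcorners-zero i)))

-- Binary weights

wtAux-zero : ∀ f → wtAux f 0 ≡ 0
wtAux-zero zero    = refl
wtAux-zero (suc f) = wtAux-zero f

n/2≤ : ∀ {n f} → n ≤ suc f → n / 2 ≤ f
n/2≤ {zero}  _ = z≤n
n/2≤ {suc n} (s≤s n≤f) = ℕ.≤-trans (ℕ.s≤s⁻¹ (ℕ.m/n<m (suc n) 2 (s≤s (s≤s z≤n)))) n≤f

wtAux-fuel : ∀ f g n → n ≤ f → n ≤ g → wtAux f n ≡ wtAux g n
wtAux-fuel zero    g       zero _ _ = sym (wtAux-zero g)
wtAux-fuel (suc f) zero    zero _ _ = wtAux-zero f
wtAux-fuel (suc f) (suc g) n n≤f n≤g = cong (_+_ (n % 2)) (wtAux-fuel f g (n / 2) (n/2≤ n≤f) (n/2≤ n≤g))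

wt-step : ∀ n → wt n ≡ n % 2 + wt (n / 2)
wt-step zero    = refl
wt-step (suc n) = cong (_+_ (suc n % 2)) (wtAux-fuel n (suc n / 2) (suc n / 2) (n/2≤ ℕ.≤-refl) ℕ.≤-refl)

wt-dbl : ∀ l → wt (dbl l) ≡ wt l
wt-dbl l = trans (wt-step (dbl l)) (cong₂ (λ a b → a + wt b)
  (trans (cong (_% 2) e) (ℕ.m*n%n≡0 l 2)) (trans (cong (_/ 2) e) (ℕ.m*n/n≡m l 2)))
  where e = trans (dbl≡2* l) (ℕ.*-comm 2 l)

wt-suc-dbl : ∀ l → wt (suc (dbl l)) ≡ suc (wt l)
wt-suc-dbl l = trans (wt-step (suc (dbl l))) (cong₂ (λ a b → a + wt b)
  (trans (cong (λ z → suc z % 2) e) (ℕ.[m+kn]%n≡m%n 1 l 2))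
  (trans (cong (λ z → suc z / 2) e) (trans (ℕ.+-distrib-/-∣ʳ 1 {l * 2} {2} (divides l refl)) (ℕ.m*n/n≡m l 2))))
  where e = trans (dbl≡2* l) (ℕ.*-comm 2 l)

1≤2^ : ∀ r → 1 ≤ 2 ^ r
1≤2^ r = ℕ.m^n>0 2 r

dbl-+ : ∀ a b → dbl (a + b) ≡ 2 * a + dbl b
dbl-+ a b = trans (dbl≡2* (a + b)) (trans (ℕ.*-distribˡ-+ 2 a b) (cong (_+_ (2 * a)) (sym (dbl≡2* b))))

dbl-cancel-< : ∀ {a b} → dbl a < 2 * b → a < b
dbl-cancel-< {a} p = ℕ.*-cancelˡ-< 2 a _ (subst (_< _) (dbl≡2* a) p)

-- Reads the binary digits of 2^r + l: the leading 1 gives the factor 4, each further digit 0 leaves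
-- the increment unchanged and each digit 1 triples it.
Δcells-wt : ∀ r l → l < 2 ^ r → Δ cellCount (2 ^ r + l) ≡ + 4 *ℤ + (3 ^ wt l)
Δcells-wt zero    zero    l<   = Δcells-one
Δcells-wt zero    (suc l) (s≤s ())
Δcells-wt (suc r) l l< with halves l
... | _ , _ , even l' = begin
  Δ cellCount (2 ^ suc r + dbl l')   ≡⟨ cong (Δ cellCount) (dbl-+ (2 ^ r) l') ⟨
  Δ cellCount (dbl (2 ^ r + l'))     ≡⟨ Δcells-even _ (ℕ.≤-trans (1≤2^ r) (ℕ.m≤m+n _ l')) ⟩
  Δ cellCount (2 ^ r + l')           ≡⟨ Δcells-wt r l' (dbl-cancel-< l<) ⟩
  + 4 *ℤ + (3 ^ wt l')           ≡⟨ cong (λ z → + 4 *ℤ + (3 ^ z)) (wt-dbl l') ⟨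
  + 4 *ℤ + (3 ^ wt (dbl l'))     ∎
  where open ≡-Reasoning
... | _ , _ , odd l' = begin
  Δ cellCount (2 ^ suc r + suc (dbl l'))
    ≡⟨ cong (Δ cellCount) (trans (ℕ.+-suc _ _) (cong suc (sym (dbl-+ (2 ^ r) l')))) ⟩
  Δ cellCount (suc (dbl (2 ^ r + l')))
    ≡⟨ Δcells-odd _ (ℕ.≤-trans (1≤2^ r) (ℕ.m≤m+n _ l')) ⟩
  + 3 *ℤ Δ cellCount (2 ^ r + l')
    ≡⟨ cong (_*ℤ_ (+ 3)) (Δcells-wt r l' (dbl-cancel-< (ℕ.<-trans (ℕ.n<1+n _) l<))) ⟩
  + 3 *ℤ (+ 4 *ℤ + (3 ^ wt l'))
    ≡⟨ swap (+ (3 ^ wt l')) ⟩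
  + 4 *ℤ (+ 3 *ℤ + (3 ^ wt l'))
    ≡⟨ cong (_*ℤ_ (+ 4)) (ℤ.pos-* 3 (3 ^ wt l')) ⟨
  + 4 *ℤ + (3 ^ suc (wt l'))
    ≡⟨ cong (λ z → + 4 *ℤ + (3 ^ z)) (wt-suc-dbl l') ⟨
  + 4 *ℤ + (3 ^ wt (suc (dbl l'))) ∎
  where
  open ≡-Reasoning
  swap : ∀ a → + 3 *ℤ (+ 4 *ℤ a) ≡ + 4 *ℤ (+ 3 *ℤ a)
  swap = solve-∀

-- The difference at stages 4n + 1

-- At stage 4(n + 1) + 1 the difference is the increment of the holes from stage 4(n + 1) - 1, which
-- is `tower 2 n`, to 4(n + 1).
fourδ-suc : ∀ n → fourδ (suc n) ≡ Δ holeCount (tower 2 n)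
fourδ-suc n = trans (cong (λ k → + w k -ℤ + u k) index) (transpose (w (2 + t)) (u (2 + t)) _ _ (w+holes t))
  where
  t = tower 2 n
  index : 4 * suc n + 1 ≡ 2 + t
  index = begin
    4 * suc n + 1             ≡⟨ four n ⟩
    suc (2 ^ 2 * suc n)       ≡⟨ cong suc (suc-tower 2 n) ⟨
    2 + t                     ∎
    where
    open ≡-Reasoning
    four : ∀ n → 4 * suc n + 1 ≡ suc (4 * suc n)
    four n = ℕ.+-comm (4 * suc n) 1
  transpose : ∀ a b c d → a + c ≡ b + d → + a -ℤ + b ≡ + d -ℤ + c
  transpose a b c d e = trans (lemma₁ (+ a) (+ b) (+ c))
    (trans (cong (λ z → + z -ℤ + b -ℤ + c) e) (lemma₂ (+ b) (+ d) (+ c)))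
    where
    lemma₁ : ∀ a b c → a -ℤ b ≡ ((a +ℤ c) -ℤ b) -ℤ c
    lemma₁ = solve-∀
    lemma₂ : ∀ b d c → ((b +ℤ d) -ℤ b) -ℤ c ≡ d -ℤ c
    lemma₂ = solve-∀

fourδ-tower : ∀ {n} i s → n ≡ 2 ^ i * suc s → fourδ n ≡ Δ holeCount (tower (2 + i) s)
fourδ-tower i s e = trans (cong fourδ (trans e (sym (suc-tower i s)))) (fourδ-suc (tower i s))

fourδ-power : ∀ k → fourδ (2 ^ k) ≡ ZeroTower.powers k
fourδ-power k = trans (fourδ-tower k 0 (sym (ℕ.*-identityʳ (2 ^ k)))) (ZeroTower.Δholes-zero k)

-- The odd part is 2p + 1 with p = 2^r + l, so the increment `v` is that of the cells at p. Of the
-- two levels due to the factor 4, one is lost to the lag of the holes, whence the exponent m + 1.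
fourδ-generic : ∀ m r l → l < 2 ^ r → fourδ (2 ^ m * suc (dbl (2 ^ r + l))) ≡
  + 4 *ℤ (+ 4 *ℤ (+ (3 ^ (m + 1)) -ℤ + (2 ^ (m + 1))) *ℤ + (3 ^ wt l))
fourδ-generic m r l l< = begin
  fourδ (2 ^ m * suc (dbl p))
    ≡⟨ fourδ-tower m (dbl p) refl ⟩
  Δ holeCount (tower (2 + m) (dbl p))
    ≡⟨ EvenTower.Δholes-tower p 1≤p (suc m) ⟩
  + 4 *ℤ (+ (3 ^ suc m) -ℤ + (2 ^ suc m)) *ℤ Δ cellCount (dbl p)
    ≡⟨ cong₂ (λ z v → + 4 *ℤ (+ (3 ^ z) -ℤ + (2 ^ z)) *ℤ v) (ℕ.+-comm 1 m)
             (trans (Δcells-even p 1≤p) (Δcells-wt r l l<)) ⟩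
  + 4 *ℤ (+ (3 ^ (m + 1)) -ℤ + (2 ^ (m + 1))) *ℤ (+ 4 *ℤ + (3 ^ wt l))
    ≡⟨ lemma (+ (3 ^ (m + 1)) -ℤ + (2 ^ (m + 1))) (+ (3 ^ wt l)) ⟩
  + 4 *ℤ (+ 4 *ℤ (+ (3 ^ (m + 1)) -ℤ + (2 ^ (m + 1))) *ℤ + (3 ^ wt l)) ∎
  where
  open ≡-Reasoning
  p = 2 ^ r + l
  1≤p : 1 ≤ p
  1≤p = ℕ.≤-trans (1≤2^ r) (ℕ.m≤m+n _ l)
  lemma : ∀ d t → + 4 *ℤ d *ℤ (+ 4 *ℤ t) ≡ + 4 *ℤ (+ 4 *ℤ d *ℤ t)
  lemma = solve-∀

-- f is a variable because comparing fourδ 1 with fourδ (2 ^ 0) would evaluate the automata.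
at-1-and-2 : (f : ℕ → ℤ) → (∀ k → f (2 ^ k) ≡ ZeroTower.powers k) →
             (f 1 ≡ + 4 *ℤ + 1) × (f 2 ≡ + 4 *ℤ + 6)
at-1-and-2 f f-power = f-power 0 , f-power 1

theorem11 : (fourδ 0 ≡ + 4 *ℤ + 0)
    × (fourδ 1 ≡ + 4 *ℤ + 1)
    × (fourδ 2 ≡ + 4 *ℤ + 6)
    × (∀ (n k j m l : ℕ) → 3 ≤ n → n ≡ 2 ^ k + j → 1 ≤ j → j ≤ 2 ^ k
    → j ≡ 2 ^ m * (2 * l + 1)
    → (j ≢ 2 ^ k
    → fourδ n ≡ + 4 *ℤ (+ 4 *ℤ (+ (3 ^ (m + 1)) -ℤ + (2 ^ (m + 1))) *ℤ + (3 ^ wt l)))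
    × (j ≡ 2 ^ k
    → fourδ n ≡ + 4 *ℤ (+ 4 *ℤ + (3 ^ (k + 1)) -ℤ + 3 *ℤ + (2 ^ (k + 1)))))
theorem11 = refl , proj₁ small , proj₂ small , λ n k j m l _ n≡ _ j≤ j≡ →
  below n k j m l n≡ j≤ j≡ , top n k j n≡
  where
  small = at-1-and-2 fourδ fourδ-power

  top : ∀ n k j → n ≡ 2 ^ k + j → j ≡ 2 ^ k →
        fourδ n ≡ + 4 *ℤ (+ 4 *ℤ + (3 ^ (k + 1)) -ℤ + 3 *ℤ + (2 ^ (k + 1)))
  top n k j refl refl = begin
    fourδ (2 ^ k + 2 ^ k)
      ≡⟨ cong (λ z → fourδ (2 ^ k + z)) (ℕ.+-identityʳ (2 ^ k)) ⟨
    fourδ (2 ^ suc k)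
      ≡⟨ cong (λ z → fourδ (2 ^ z)) (ℕ.+-comm 1 k) ⟩
    fourδ (2 ^ (k + 1))
      ≡⟨ fourδ-power (k + 1) ⟩
    ZeroTower.powers (k + 1)
      ≡⟨ lemma (+ (3 ^ (k + 1))) (+ (2 ^ (k + 1))) ⟩
    + 4 *ℤ (+ 4 *ℤ + (3 ^ (k + 1)) -ℤ + 3 *ℤ + (2 ^ (k + 1))) ∎
    where
    open ≡-Reasoning
    lemma : ∀ a b → + 16 *ℤ a -ℤ + 12 *ℤ b ≡ + 4 *ℤ (+ 4 *ℤ a -ℤ + 3 *ℤ b)
    lemma = solve-∀

  -- The odd factor is at least 1, so 2^m ≤ j < 2^k.
  m<k : ∀ k m l → 2 ^ m * (2 * l + 1) ≤ 2 ^ k → 2 ^ m * (2 * l + 1) ≢ 2 ^ k → m < k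
  m<k k m l j≤ j≢ = ℕ.≰⇒> (λ k≤m → ℕ.<⇒≱ 2^m<2^k (ℕ.^-monoʳ-≤ 2 k≤m))
    where
    2^m<2^k : 2 ^ m < 2 ^ k
    2^m<2^k = ℕ.≤-<-trans (ℕ.m≤m*n (2 ^ m) (2 * l + 1) {{ℕ.>-nonZero (ℕ.m≤n+m 1 (2 * l))}})
                          (ℕ.≤∧≢⇒< j≤ j≢)

  below : ∀ n k j m l → n ≡ 2 ^ k + j → j ≤ 2 ^ k → j ≡ 2 ^ m * (2 * l + 1) → j ≢ 2 ^ k →
          fourδ n ≡ + 4 *ℤ (+ 4 *ℤ (+ (3 ^ (m + 1)) -ℤ + (2 ^ (m + 1))) *ℤ + (3 ^ wt l))
  below n k j m l refl j≤ refl j≢ with ℕ.m≤n⇒∃[o]m+o≡n (m<k k m l j≤ j≢)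
  -- With k = m + 1 + r the power 2^k adds 2·2^r to the odd factor: n = 2^m (2 (2^r + l) + 1).
  ... | r , refl = trans (cong fourδ n≡) (fourδ-generic m r l l<)
    where
    open ≡-Reasoning
    2^k≡ : 2 ^ suc (m + r) ≡ 2 ^ m * (2 * 2 ^ r)
    2^k≡ = trans (cong (2 ^_) (sym (ℕ.+-suc m r))) (ℕ.^-distribˡ-+-* 2 m (suc r))

    n≡ : 2 ^ suc (m + r) + 2 ^ m * (2 * l + 1) ≡ 2 ^ m * suc (dbl (2 ^ r + l))
    n≡ = begin
      2 ^ suc (m + r) + 2 ^ m * (2 * l + 1)    ≡⟨ cong (_+ 2 ^ m * (2 * l + 1)) 2^k≡ ⟩
      2 ^ m * (2 * 2 ^ r) + 2 ^ m * (2 * l + 1) ≡⟨ lemma (2 ^ m) (2 ^ r) l ⟩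
      2 ^ m * suc (2 * (2 ^ r + l))            ≡⟨ cong (λ z → 2 ^ m * suc z) (dbl≡2* (2 ^ r + l)) ⟨
      2 ^ m * suc (dbl (2 ^ r + l))            ∎
      where
      lemma : ∀ a b l → a * (2 * b) + a * (2 * l + 1) ≡ a * (1 + 2 * (b + l))
      lemma = ℕRing.solve-∀

    l< : l < 2 ^ r
    -- Cancelling 2^m in j < 2^k leaves 2l + 1 < 2·2^r.
    l< = ℕ.*-cancelˡ-< 2 l (2 ^ r) (ℕ.<-trans (ℕ.m<m+n (2 * l) (s≤s z≤n))
           (ℕ.*-cancelˡ-< (2 ^ m) _ _ (subst (2 ^ m * (2 * l + 1) <_) 2^k≡ (ℕ.≤∧≢⇒< j≤ j≢))))
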